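{- Let $n\ge 5$ be an integer and let $K=\{123,132,321\}$. The number of equivalence classes of $S_n$ under $K$-equivalence is $(n-1)!!+(n-2)!!+n-2$.
   Context: Permutations in $S_n$ are written as words $\pi_1\pi_2\cdots\pi_n$ in one-line notation. The order permutation of a word $u$ of $c$ distinct positive integers is the unique $\sigma\in S_c$ with $\sigma_i<\sigma_j$ iff $u_i<u_j$. A replacement partition $K$ of $S_c$ is a set partition of $S_c$; it is denoted by listing its parts with the one-element parts (and outer brackets) omitted, so here $K$ is the set partition of $S_3$ whose only part of size greater than one is $\{123,132,321\}$. The $K$-equivalence on $S_n$ is the equivalence relation generated by: $\phi\equiv\psi$ whenever $\phi=aub$ and $\psi=avb$ (concatenations) for some possibly empty words $a,b$ and words $u,v$ of length $c$ (so $u,v$ occupy the same $c$ consecutive positions) such that the order permutations of $u$ and $v$ lie in the same part of $K$. All equivalence classes are counted, including one-element classes. $m!!$ is the double factorial: the product of all positive integers at most $m$ having the same parity as $m$. -}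

module Defs where

open import Data.Fin.Base using (Fin)
open import Data.List.Base using (List; []; _∷_; _++_)
open import Data.List.Membership.Propositional using (_∈_)
open import Data.List.Relation.Binary.Disjoint.Propositional using (Disjoint)
open import Data.List.Relation.Unary.All using ([])
open import Data.List.Relation.Unary.AllPairs using (AllPairs; []; _∷_)
open import Data.List.Relation.Unary.Any using (Any)
open import Data.Nat.Base using (ℕ; zero; suc; _*_; _≤_; _<_)
open import Data.Nat.Properties using (_≤?_; _≟_)
open import Data.Product.Base using (_×_)
open import Data.Sum.Base using (_⊎_)
open import Data.Vec.Base using (Vec; []; _∷_; lookup; toList)
open import Data.Vec.Relation.Unary.All using (All; all?)
open import Data.Vec.Relation.Unary.AllPairs using (allPairs?)
open import Data.Vec.Relation.Unary.Unique.Propositional using (Unique)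
open import Function.Bundles using (_⇔_; Inverse)
open import Level using (Level; 0ℓ; _⊔_)
open import Relation.Binary.Bundles using (Setoid)
open import Relation.Binary.Construct.Closure.Equivalence using (setoid)
open import Relation.Binary.PropositionalEquality.Core using (_≡_)
import Relation.Binary.PropositionalEquality.Properties as ≡
open import Relation.Nullary.Decidable using (Dec; from-yes; ¬?; _×-dec_)

private
  variable
    a ℓ : Level
    c n : ℕ

IsPermutation : Vec ℕ n → Set
IsPermutation {n} w = All (λ x → 1 ≤ x × x ≤ n) w × Unique w

isPermutation? : (w : Vec ℕ n) → Dec (IsPermutation w)
isPermutation? {n} w =
  all? (λ x → (1 ≤? x) ×-dec (x ≤? n)) w ×-dec allPairs? (λ x y → ¬? (x ≟ y)) w

-- One-line notation, with letters 1, …, n.  The proof field is irrelevant, so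
-- that permutations with the same word are equal; a relevant proof can be
-- recovered by recomputing `isPermutation? word`.
record S (n : ℕ) : Set where
  constructor permutation
  field
    word           : Vec ℕ n
    .isPermutation : IsPermutation word

open S public

IsOrderPermutation : Vec ℕ c → S c → Set
IsOrderPermutation u σ =
  ∀ i j → (lookup (word σ) i < lookup (word σ) j) ⇔ (lookup u i < lookup u j)

-- A set partition of S c, given by some of its parts: every permutation that
-- lies in no listed part forms a part by itself.
record ReplacementPartition (c : ℕ) : Set where
  field
    parts    : List (List (S c))
    disjoint : AllPairs Disjoint parts

SamePart : ReplacementPartition c → S c → S c → Set
SamePart K σ τ = σ ≡ τ ⊎ Any (λ part → σ ∈ part × τ ∈ part) parts
  where open ReplacementPartition K

record Replacement (K : ReplacementPartition c) (φ ψ : S n) : Set where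
  field
    prefix suffix : List ℕ
    u v           : Vec ℕ c
    φ≡            : toList (word φ) ≡ prefix ++ toList u ++ suffix
    ψ≡            : toList (word ψ) ≡ prefix ++ toList v ++ suffix
    σ τ           : S c
    σ-order       : IsOrderPermutation u σ
    τ-order       : IsOrderPermutation v τ
    samePart      : SamePart K σ τ

-- S n, with the K-equivalence as its equality.
S[_]/_ : ∀ n → ReplacementPartition c → Setoid 0ℓ 0ℓ
S[ n ]/ K = setoid (Replacement {n = n} K)

-- An equivalence relation has m classes when its quotient is in bijection with
-- a set of m elements.
HasClassCount : Setoid a ℓ → ℕ → Set (a ⊔ ℓ)
HasClassCount A m = Inverse A (≡.setoid (Fin m))

perm123 perm132 perm321 : S 3
perm123 = permutation w (from-yes (isPermutation? w)) where w = 1 ∷ 2 ∷ 3 ∷ []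
perm132 = permutation w (from-yes (isPermutation? w)) where w = 1 ∷ 3 ∷ 2 ∷ []
perm321 = permutation w (from-yes (isPermutation? w)) where w = 3 ∷ 2 ∷ 1 ∷ []

K : ReplacementPartition 3
K = record
  { parts    = (perm123 ∷ perm132 ∷ perm321 ∷ []) ∷ []
  ; disjoint = [] ∷ []
  }

infix 8 _!!

_!! : ℕ → ℕ
zero !!        = 1
suc zero !!    = 1
suc (suc m) !! = suc (suc m) * m !!

{-# OPTIONS --safe #-}
module Submission where

-- Write a word with letters in place of a permutation, and allow the moves abc → acb
-- and abc → cba whenever a ≤ b ≤ c.  A window of three letters admits a move, in one
-- direction or the other, exactly when it starts with its smallest letter or
-- decreases weakly (`Bad`).
--
-- Immovable permutations, those without such a window, are alone in their classes.
-- At most one letter follows the letter 1 in such a word, as 1 must not start a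
-- window.  If the word is q1t, then t is arbitrary and q1 is immovable; if it is q1,
-- then q ends with an ascent (or has at most one letter), which is the condition for
-- q1 to be immovable whenever q is.  The immovable words that stay so when a smaller
-- letter is appended are thus obtained by choosing t among m - 1 letters and then a
-- word of the same kind on m - 2 letters, so there are (m-1)!! of them on m letters
-- (`spell`, `Code↔Fin`).  The permutations q1t of 1, ..., n are these words with
-- m = n, and the permutations q1 come from those with m = n - 1; this yields the terms
-- (n-1)!! and (n-2)!!.
--
-- For the other permutations, the smallest letter a of a tail moves over two letters
-- at a time, and all rearrangements of the letters after it are equivalent
-- (`rearrange-after-min`).  More generally, let v₁ ≥ ... ≥ vₘ be at most the other
-- letters and occupy alternate positions, v₁x₁v₂x₂...vₘxₘxₘ₊₁..., possibly after one
-- further letter t, with at least two letters after vₘ.  Then all arrangements of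
-- the x's are equivalent (`rearrange`), as are those of the x's together with t if
-- there are at least four of them (`rearrange-odd`, where n ≥ 5 enters).
-- Every movable word is equivalent to one of this form: by induction on the length,
-- it suffices to put a letter in front of such a word (`standard-∷`), as a window at
-- the front of a word of more than three letters can be brought into the tail.  For a
-- permutation the v's are m, ..., 1, so its class is determined by m and the parity of
-- their positions, which leaves n - 2 possibilities (`canonical-form`).
--
-- These classes are different.  If the letters at most j occur in decreasing order and
-- all on positions of the same parity, then no move changes their order or the parity
-- of their positions (`tagged-≈`), because in a window that moves only the smallest
-- letter can be at most j.  Taking for j the larger of the numbers of v's
-- in two canonical words tells them apart (`canonical-distinct`).

open import Defs
open import Data.Bool.Base using (Bool; true; false; not)
open import Data.Bool.Properties using (not-involutive)
open import Data.Empty using (⊥-elim)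
open import Data.Fin.Base as Fin using (Fin; zero; suc; toℕ; fromℕ<)
open import Data.Fin.Properties as Fin using (1↔⊤; *↔×; +↔⊎; toℕ-injective; toℕ<n; toℕ-fromℕ<)
open import Data.List.Base as List using (List; []; _∷_; _++_; _ʳ++_; filter; initLast; length; _∷ʳ′_)
open import Data.List.Membership.Propositional using (_∈_; find)
open import Data.List.Membership.Propositional.Properties using (∈-∃++; ∈-++⁻; ∈-++⁺ˡ; ∈-++⁺ʳ)
open import Data.List.Properties
  using (++-assoc; ++-identityʳ; length-++; ∷-injective; ∷-injectiveˡ; ∷ʳ-injective; ∷ʳ-injectiveˡ;
         ∷ʳ-injectiveʳ; filter-accept; filter-reject)
open import Data.List.Relation.Binary.Permutation.Propositional as ↭
  using (_↭_; prep; swap; ↭-refl; ↭-reflexive; ↭-sym; ↭-trans)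
open import Data.List.Relation.Binary.Permutation.Propositional.Properties
  using (All-resp-↭; ↭-length; ++-comm; ++⁺ˡ; drop-∷; ∈-resp-↭; shift; ++↭ʳ++; filter-↭;
         ↭-empty-inv; ↭-singleton-inv)
import Data.List.Relation.Binary.Permutation.Setoid.Properties as Permutationₛ
open import Data.List.Relation.Binary.Subset.Propositional using (_⊆_)
open import Data.List.Relation.Unary.All as All using (All; []; _∷_; all?)
open import Data.List.Relation.Unary.All.Properties using (++⁺; ++⁻; ¬All⇒Any¬) 
  renaming (map⁺ to All-map⁺)
open import Data.List.Relation.Unary.AllPairs as AllPairs using (AllPairs; []; _∷_)
open import Data.List.Relation.Unary.AllPairs.Properties using (map⁺)
open import Data.List.Relation.Unary.Any using (here; there)
open import Data.List.Relation.Unary.Linked.Properties using (Linked⇒AllPairs)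
open import Data.List.Relation.Unary.Unique.Propositional using (Unique)
open import Data.Nat.Base
  using (ℕ; zero; suc; _+_; _∸_; ⌊_/2⌋; _≤_; _≥_; _<_; z≤n; s≤s; s≤s⁻¹)
open import Data.Nat.Properties
open import Data.List.Sort ≤-decTotalOrder using (sort; sort-↭; sort-↗)
open import Data.Product.Base using (_×_; _,_; ∃; ∃₂; proj₁; proj₂)
open import Data.Product.Function.NonDependent.Propositional using (_×-↔_)
open import Data.Sum.Base using (_⊎_; inj₁; inj₂)
open import Data.Sum.Function.Propositional using (_⊎-↔_)
open import Data.Unit.Base using (⊤; tt)
open import Data.Vec.Base using (Vec; []; _∷_; fromList; lookup; removeAt; toList)
open import Data.Vec.Properties using (cast-is-id; length-toList; toList-injective; toList∘fromList)
import Data.Vec.Relation.Unary.All.Properties as VecAll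
import Data.Vec.Relation.Unary.AllPairs as VecAllPairs
open import Function.Base using (case_of_)
open import Function.Bundles using (_⇔_; _↔_; mk⇔; mk↔ₛ′; Equivalence; Inverse)
open import Function.Construct.Composition using (_⇔-∘_; _↔-∘_)
open import Function.Construct.Identity using (↔-id)
open import Function.Construct.Symmetry using (⇔-sym; ↔-sym)
open import Relation.Binary.Bundles using (Setoid)
import Relation.Binary.Construct.Closure.Equivalence as EqClosure
open import Relation.Binary.Construct.Closure.ReflexiveTransitive using (ε; _◅_)
open import Relation.Binary.Construct.Closure.Symmetric using (fwd; bwd)
open import Relation.Binary.Definitions using (tri<; tri≈; tri>)
open import Relation.Binary.PropositionalEquality.Core
  using (_≡_; _≢_; refl; sym; trans; cong; cong₂; subst; subst₂)
import Relation.Binary.PropositionalEquality.Properties as ≡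
open import Relation.Nullary using (¬_; Dec; yes; no)
open import Relation.Nullary.Decidable using (map′; recompute; _×-dec_; _⊎-dec_)

private
  variable
    a b c m n t v x y z : ℕ
    s w w′ T V L L₁ L₂ : List ℕ

-- Moves

-- Moves on words.  The inequalities are weak, so that no distinctness of letters has to
-- be carried along; on permutations they are strict.
data _⟶_ : List ℕ → List ℕ → Set where
  123→132 : a ≤ b → b ≤ c → (a ∷ b ∷ c ∷ s) ⟶ (a ∷ c ∷ b ∷ s)
  123→321 : a ≤ b → b ≤ c → (a ∷ b ∷ c ∷ s) ⟶ (c ∷ b ∷ a ∷ s)
  there   : w ⟶ w′ → (x ∷ w) ⟶ (x ∷ w′)

infix 4 _⟶_ _≈_

-- The equivalence generated by the moves.
_≈_ : List ℕ → List ℕ → Set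
_≈_ = EqClosure.EqClosure _⟶_

open Setoid (EqClosure.setoid _⟶_) using ()
  renaming (refl to ≈-refl; sym to ≈-sym; trans to ≈-trans; reflexive to ≈-reflexive)
open import Relation.Binary.Reasoning.Setoid (EqClosure.setoid _⟶_)

∷⁺ : ∀ x {w w′} → w ≈ w′ → x ∷ w ≈ x ∷ w′
∷⁺ x = EqClosure.gmap (x ∷_) there

prefix⁺ : ∀ p {w w′} → w ≈ w′ → p ++ w ≈ p ++ w′
prefix⁺ []      e = e
prefix⁺ (x ∷ p) e = ∷⁺ x (prefix⁺ p e)

flip-tail : a ≤ b → b ≤ c → a ∷ b ∷ c ∷ s ≈ a ∷ c ∷ b ∷ s
flip-tail a≤b b≤c = fwd (123→132 a≤b b≤c) ◅ ε

reversal : a ≤ b → b ≤ c → a ∷ b ∷ c ∷ s ≈ c ∷ b ∷ a ∷ s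
reversal a≤b b≤c = fwd (123→321 a≤b b≤c) ◅ ε

-- Rearrangement behind a smallest letter

swap₁ : ∀ x y → a ≤ x → a ≤ y → a ∷ x ∷ y ∷ s ≈ a ∷ y ∷ x ∷ s
swap₁ x y a≤x a≤y with ≤-total x y
... | inj₁ x≤y = flip-tail a≤x x≤y
... | inj₂ y≤x = ≈-sym (flip-tail a≤y y≤x)

-- A smallest letter changes places with the descending pair behind it.
hop : a ≤ y → y ≤ x → a ∷ x ∷ y ∷ s ≈ x ∷ y ∷ a ∷ s
hop a≤y y≤x = ≈-trans (≈-sym (flip-tail a≤y y≤x)) (reversal a≤y y≤x)

-- The second and third letters behind a smallest letter may be exchanged.  If x is not
-- the least of the three, y is exchanged with it first, so that x, y, z then form a window
-- with its minimum y in front.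
swap₂-≤ : ∀ x y z → a ≤ x → a ≤ y → a ≤ z → y ≤ z →
  a ∷ x ∷ y ∷ z ∷ s ≈ a ∷ x ∷ z ∷ y ∷ s
swap₂-≤ {a} {s} x y z a≤x a≤y a≤z y≤z with ≤-total x y | ≤-total x z
... | inj₁ x≤y | _        = ∷⁺ a (flip-tail x≤y y≤z)
... | inj₂ y≤x | inj₁ x≤z = begin
  a ∷ x ∷ y ∷ z ∷ s ≈⟨ swap₁ x y a≤x a≤y ⟩
  a ∷ y ∷ x ∷ z ∷ s ≈⟨ ∷⁺ a (reversal y≤x x≤z) ⟩
  a ∷ z ∷ x ∷ y ∷ s ≈⟨ swap₁ z x a≤z a≤x ⟩
  a ∷ x ∷ z ∷ y ∷ s ∎
... | inj₂ y≤x | inj₂ z≤x = begin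
  a ∷ x ∷ y ∷ z ∷ s ≈⟨ swap₁ x y a≤x a≤y ⟩
  a ∷ y ∷ x ∷ z ∷ s ≈⟨ ∷⁺ a (flip-tail y≤z z≤x) ⟨
  a ∷ y ∷ z ∷ x ∷ s ≈⟨ ∷⁺ a (reversal y≤z z≤x) ⟩
  a ∷ x ∷ z ∷ y ∷ s ∎

swap₂ : ∀ x y z → a ≤ x → a ≤ y → a ≤ z → a ∷ x ∷ y ∷ z ∷ s ≈ a ∷ x ∷ z ∷ y ∷ s
swap₂ x y z a≤x a≤y a≤z with ≤-total y z
... | inj₁ y≤z = swap₂-≤ x y z a≤x a≤y a≤z y≤z
... | inj₂ z≤y = ≈-sym (swap₂-≤ x z y a≤x a≤z a≤y z≤y)

-- Further to the right, the smallest letter first hops over two letters.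
swap-after-min : ∀ p x y → All (a ≤_) p → a ≤ x → a ≤ y →
  a ∷ p ++ x ∷ y ∷ s ≈ a ∷ p ++ y ∷ x ∷ s
swap-after-min []          x y []         a≤x a≤y = swap₁ x y a≤x a≤y
swap-after-min (u ∷ [])    x y (a≤u ∷ []) a≤x a≤y = swap₂ u x y a≤u a≤x a≤y
swap-after-min {a} {s} (u ∷ v ∷ p) x y (a≤u ∷ a≤v ∷ a≤p) a≤x a≤y with ≤-total v u
... | inj₁ v≤u = begin
  a ∷ u ∷ v ∷ p ++ x ∷ y ∷ s ≈⟨ hop a≤v v≤u ⟩
  u ∷ v ∷ a ∷ p ++ x ∷ y ∷ s ≈⟨ ∷⁺ u (∷⁺ v (swap-after-min p x y a≤p a≤x a≤y)) ⟩
  u ∷ v ∷ a ∷ p ++ y ∷ x ∷ s ≈⟨ hop a≤v v≤u ⟨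
  a ∷ u ∷ v ∷ p ++ y ∷ x ∷ s ∎
... | inj₂ u≤v = begin
  a ∷ u ∷ v ∷ p ++ x ∷ y ∷ s ≈⟨ reversal a≤u u≤v ⟩
  v ∷ u ∷ a ∷ p ++ x ∷ y ∷ s ≈⟨ ∷⁺ v (∷⁺ u (swap-after-min p x y a≤p a≤x a≤y)) ⟩
  v ∷ u ∷ a ∷ p ++ y ∷ x ∷ s ≈⟨ reversal a≤u u≤v ⟨
  a ∷ u ∷ v ∷ p ++ y ∷ x ∷ s ∎

-- Invariance under permutations of the argument reduces to adjacent exchanges; P holds
-- for the lists for which these are available.
rearrange-by-swaps : (f : List ℕ → List ℕ) (P : List ℕ → Set) →
  (∀ {L L′} → L ↭ L′ → P L → P L′) →
  (∀ p x y s → P (p ++ x ∷ y ∷ s) → f (p ++ x ∷ y ∷ s) ≈ f (p ++ y ∷ x ∷ s)) →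
  ∀ {L L′} → L ↭ L′ → P L → f L ≈ f L′
rearrange-by-swaps f P resp swaps = go []
  where
  regroup : ∀ p x s → f (p ++ x ∷ s) ≡ f ((p ++ x ∷ []) ++ s)
  regroup p x s = cong f (sym (++-assoc p (x ∷ []) s))

  go : ∀ p {L L′} → L ↭ L′ → P (p ++ L) → f (p ++ L) ≈ f (p ++ L′)
  go p _↭_.refl           P-L = ≈-refl
  go p (prep {xs} {ys} x q)     P-L = begin
    f (p ++ x ∷ xs)           ≡⟨ regroup p x xs ⟩
    f ((p ++ x ∷ []) ++ xs)   ≈⟨ go (p ++ x ∷ []) q (subst P (sym (++-assoc p (x ∷ []) xs)) P-L) ⟩
    f ((p ++ x ∷ []) ++ ys)   ≡⟨ regroup p x ys ⟨
    f (p ++ x ∷ ys)           ∎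
  go p (swap {xs} {ys} x y q)   P-L = begin
    f (p ++ x ∷ y ∷ xs)               ≈⟨ swaps p x y xs P-L ⟩
    f (p ++ y ∷ x ∷ xs)               ≡⟨ cong f (++-assoc p (y ∷ x ∷ []) xs) ⟨
    f ((p ++ y ∷ x ∷ []) ++ xs)       ≈⟨ go (p ++ y ∷ x ∷ []) q P-yx ⟩
    f ((p ++ y ∷ x ∷ []) ++ ys)       ≡⟨ cong f (++-assoc p (y ∷ x ∷ []) ys) ⟩
    f (p ++ y ∷ x ∷ ys)               ∎
    where
    P-yx : P ((p ++ y ∷ x ∷ []) ++ xs)
    P-yx = subst P (sym (++-assoc p (y ∷ x ∷ []) xs)) (resp (++⁺ˡ p (swap x y ↭-refl)) P-L)
  go p (_↭_.trans q r)    P-L = ≈-trans (go p q P-L) (go p r (resp (++⁺ˡ p q) P-L))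

-- The letters of s need not be at least a.
rearrange-after-min : ∀ {p p′} → p ↭ p′ → All (a ≤_) p → a ∷ p ++ s ≈ a ∷ p′ ++ s
rearrange-after-min {a} {s} = rearrange-by-swaps (λ p → a ∷ p ++ s) (All (a ≤_)) All-resp-↭ swaps
  where
  swaps : ∀ p x y r → All (a ≤_) (p ++ x ∷ y ∷ r) →
    a ∷ (p ++ x ∷ y ∷ r) ++ s ≈ a ∷ (p ++ y ∷ x ∷ r) ++ s
  swaps p x y r a≤ with a≤p , a≤x ∷ a≤y ∷ _ ← ++⁻ p a≤ = begin
    a ∷ (p ++ x ∷ y ∷ r) ++ s ≡⟨ cong (a ∷_) (++-assoc p (x ∷ y ∷ r) s) ⟩
    a ∷ p ++ x ∷ y ∷ r ++ s   ≈⟨ swap-after-min p x y a≤p a≤x a≤y ⟩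
    a ∷ p ++ y ∷ x ∷ r ++ s   ≡⟨ cong (a ∷_) (++-assoc p (y ∷ x ∷ r) s) ⟨
    a ∷ (p ++ y ∷ x ∷ r) ++ s ∎

-- Rearrangement of interleavings

infixr 5 _⋈_

-- Interleaving: v₁x₁v₂x₂..., continued by the letters x that are left over.  It is only
-- used when there are more letters x than letters v.
_⋈_ : List ℕ → List ℕ → List ℕ
[]      ⋈ L       = L
(v ∷ V) ⋈ []      = v ∷ V
(v ∷ V) ⋈ (x ∷ L) = v ∷ x ∷ V ⋈ L

⋈-singleton : ∀ L → (v ∷ []) ⋈ L ≡ v ∷ L
⋈-singleton []      = refl
⋈-singleton (_ ∷ _) = refl

infix 4 _≼_

-- Every letter of V is at most every letter of L.
_≼_ : List ℕ → List ℕ → Set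
V ≼ L = All (λ v → All (v ≤_) L) V

≼-head : V ≼ x ∷ L → All (_≤ x) V
≼-head = All.map All.head

≼-tail : V ≼ x ∷ L → V ≼ L
≼-tail = All.map All.tail

≼-cons : All (_≤ x) V → V ≼ L → V ≼ x ∷ L
≼-cons V≤x V≼L = All.zipWith (λ (p , q) → p ∷ q) (V≤x , V≼L)

below-trans : All (_≤ x) V → x ≤ y → All (_≤ y) V
below-trans V≤x x≤y = All.map (λ v≤x → ≤-trans v≤x x≤y) V≤x

≼-resp-↭ : L₁ ↭ L₂ → V ≼ L₁ → V ≼ L₂
≼-resp-↭ p = All.map (All-resp-↭ p)

mutual
  -- A descending pair in front of an interleaving can be taken into its second argument:
  -- each letter of V hops over two letters, the last one first.
  absorb : ∀ V x y → V ≼ x ∷ y ∷ L → y ≤ x → length V ≤ suc (length L) →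
    V ⋈ x ∷ y ∷ L ≈ x ∷ y ∷ V ⋈ L
  absorb []      x y _ _ _ = ≈-refl
  absorb {[]}    (v ∷ [])  x y ((_ ∷ v≤y ∷ []) ∷ []) y≤x _ = hop v≤y y≤x
  absorb {[]}    (v ∷ _ ∷ _)  x y _ _ (s≤s ())
  absorb {z ∷ L} (v ∷ V) x y ((v≤x ∷ v≤y ∷ v≤z ∷ v≤L) ∷ V≼) y≤x len = begin
    v ∷ x ∷ V ⋈ y ∷ z ∷ L   ≈⟨ absorb-two V y z v≤x v≤y v≤z (≼-tail V≼) (s≤s⁻¹ len) ⟩
    v ∷ x ∷ y ∷ z ∷ V ⋈ L   ≈⟨ hop v≤y y≤x ⟩
    x ∷ y ∷ v ∷ z ∷ V ⋈ L   ∎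

  -- Behind a and x, with a smallest, the order of the pair is irrelevant.
  absorb-two : ∀ V y z → a ≤ x → a ≤ y → a ≤ z → V ≼ y ∷ z ∷ L → length V ≤ suc (length L) →
    a ∷ x ∷ V ⋈ y ∷ z ∷ L ≈ a ∷ x ∷ y ∷ z ∷ V ⋈ L
  absorb-two [] y z _ _ _ _ _ = ≈-refl
  absorb-two {a} {x} {L} V@(v ∷ V′) y z a≤x a≤y a≤z V≼ len with ≤-total z y
  ... | inj₁ z≤y = ∷⁺ a (∷⁺ x (absorb V y z V≼ z≤y len))
  ... | inj₂ y≤z = begin
    a ∷ x ∷ V ⋈ y ∷ z ∷ L ≈⟨ ∷⁺ a (∷⁺ x (swap-⋈ v V′ [] y z V≼ (s≤s len))) ⟩
    a ∷ x ∷ V ⋈ z ∷ y ∷ L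
      ≈⟨ ∷⁺ a (∷⁺ x (absorb V z y (≼-resp-↭ (swap y z ↭-refl) V≼) y≤z len)) ⟩
    a ∷ x ∷ z ∷ y ∷ V ⋈ L ≈⟨ swap₂ x z y a≤x a≤z a≤y ⟩
    a ∷ x ∷ y ∷ z ∷ V ⋈ L ∎

  -- Adjacent letters of the second argument may be exchanged.  For the first two letters,
  -- the letters of V after v are moved out of the way.
  swap-⋈ : ∀ v V p x y → v ∷ V ≼ p ++ x ∷ y ∷ s → suc (length V) < length (p ++ x ∷ y ∷ s) →
    (v ∷ V) ⋈ (p ++ x ∷ y ∷ s) ≈ (v ∷ V) ⋈ (p ++ y ∷ x ∷ s)
  swap-⋈ {s} v [] p x y (v≤ ∷ []) _ with v≤p , v≤x ∷ v≤y ∷ _ ← ++⁻ p v≤ = begin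
    (v ∷ []) ⋈ (p ++ x ∷ y ∷ s) ≡⟨ ⋈-singleton (p ++ x ∷ y ∷ s) ⟩
    v ∷ p ++ x ∷ y ∷ s          ≈⟨ swap-after-min p x y v≤p v≤x v≤y ⟩
    v ∷ p ++ y ∷ x ∷ s          ≡⟨ ⋈-singleton (p ++ y ∷ x ∷ s) ⟨
    (v ∷ []) ⋈ (p ++ y ∷ x ∷ s) ∎
  swap-⋈ v (v′ ∷ V) (u ∷ p) x y (_ ∷ V≼) len =
    ∷⁺ v (∷⁺ u (swap-⋈ v′ V p x y (≼-tail V≼) (s≤s⁻¹ len)))
  swap-⋈ {[]} v (v′ ∷ V) [] x y _ (s≤s (s≤s ()))
  swap-⋈ {z ∷ s} v V@(_ ∷ _) [] x y ((v≤x ∷ v≤y ∷ v≤z ∷ _) ∷ V≼) len = begin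
    v ∷ x ∷ V ⋈ y ∷ z ∷ s ≈⟨ absorb-two V y z v≤x v≤y v≤z (≼-tail V≼) len′ ⟩
    v ∷ x ∷ y ∷ z ∷ V ⋈ s ≈⟨ swap₁ x y v≤x v≤y ⟩
    v ∷ y ∷ x ∷ z ∷ V ⋈ s
      ≈⟨ absorb-two V x z v≤y v≤x v≤z (≼-cons (≼-head V≼) (≼-tail (≼-tail V≼))) len′ ⟨
    v ∷ y ∷ V ⋈ x ∷ z ∷ s ∎
    where
    len′ : length V ≤ suc (length s)
    len′ = s≤s⁻¹ (s≤s⁻¹ len)

rearrange : ∀ v V → L₁ ↭ L₂ → v ∷ V ≼ L₁ → suc (length V) < length L₁ →
  (v ∷ V) ⋈ L₁ ≈ (v ∷ V) ⋈ L₂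
rearrange v V p V≼ len = rearrange-by-swaps ((v ∷ V) ⋈_)
  (λ L → v ∷ V ≼ L × suc (length V) < length L)
  (λ q (V≼ , len) → ≼-resp-↭ q V≼ , subst (suc (length V) <_) (↭-length q) len)
  (λ p x y _ (V≼ , len) → swap-⋈ v V p x y V≼ len)
  p (V≼ , len)

-- In front of an interleaving, the letters a ≤ b ≤ c meet in a window acb, which is
-- equivalent to cba.
exchange-ends : ∀ V → V ≼ a ∷ b ∷ c ∷ L → a ≤ b → b ≤ c → length V ≤ suc (length L) →
  a ∷ V ⋈ c ∷ b ∷ L ≈ c ∷ V ⋈ b ∷ a ∷ L
exchange-ends {a} {b} {c} {L} V V≼ a≤b b≤c len = begin
  a ∷ V ⋈ c ∷ b ∷ L ≈⟨ ∷⁺ a (absorb V c b (≼-cons V≤c (≼-cons V≤b V≼L)) b≤c len) ⟩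
  a ∷ c ∷ b ∷ V ⋈ L ≈⟨ flip-tail a≤b b≤c ⟨
  a ∷ b ∷ c ∷ V ⋈ L ≈⟨ reversal a≤b b≤c ⟩
  c ∷ b ∷ a ∷ V ⋈ L ≈⟨ ∷⁺ c (absorb V b a (≼-cons V≤b (≼-cons V≤a V≼L)) a≤b len) ⟨
  c ∷ V ⋈ b ∷ a ∷ L ∎
  where
  V≤a = ≼-head V≼
  V≤b = ≼-head (≼-tail V≼)
  V≤c = ≼-head (≼-tail (≼-tail V≼))
  V≼L = ≼-tail (≼-tail (≼-tail V≼))

module _ (v : ℕ) (V : List ℕ) where
  private
    infix 4 _∼_

    -- An interleaving preceded by one letter.
    W : List ℕ → List ℕ
    W []      = []
    W (t ∷ L) = t ∷ (v ∷ V) ⋈ L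

    -- The conditions on a list M under which the letters of W M can be rearranged.
    Large : List ℕ → Set
    Large M = v ∷ V ≼ M × 3 < length M × suc (suc (length V)) < length M

    Large-resp-↭ : L₁ ↭ L₂ → Large L₁ → Large L₂
    Large-resp-↭ p (V≼ , len , len′) =
      ≼-resp-↭ p V≼ , subst (3 <_) (↭-length p) len , subst (_ <_) (↭-length p) len′

    _∼_ : List ℕ → List ℕ → Set
    M ∼ N = Large M → W M ≈ W N

    W-tail : L₁ ↭ L₂ → t ∷ L₁ ∼ t ∷ L₂
    W-tail {t = t} p (V≼ , _ , len) = ∷⁺ t (rearrange v V p (≼-tail V≼) (s≤s⁻¹ len))

    -- The first letter can be exchanged with another one if a third letter lies between them
    -- in size.
    W-ends : ∀ {L} → a ≤ b → b ≤ c → a ∷ c ∷ b ∷ L ∼ c ∷ a ∷ b ∷ L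
    W-ends {a} {b} {c} {L} a≤b b≤c large@(V≼ , _ , len) = begin
      W (a ∷ c ∷ b ∷ L)
        ≈⟨ exchange-ends (v ∷ V) (≼-resp-↭ (prep a (swap c b ↭-refl)) V≼) a≤b b≤c
             (s≤s⁻¹ (s≤s⁻¹ len)) ⟩
      W (c ∷ b ∷ a ∷ L) ≈⟨ W-tail (swap b a ↭-refl) (Large-resp-↭ acb↭cba large) ⟩
      W (c ∷ a ∷ b ∷ L) ∎
      where
      acb↭cba : a ∷ c ∷ b ∷ L ↭ c ∷ b ∷ a ∷ L
      acb↭cba = _↭_.trans (swap a c ↭-refl) (prep c (swap a b ↭-refl))

    -- The least letter α of M can be brought to the front: a letter other than the two least
    -- ones, α and β, is exchanged with α directly; β is first exchanged with the fourth letter δ.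
    W-least : ∀ M → AllPairs _≤_ M → t ∷ L ↭ M → t ∷ L ∼ M
    W-least {t} {L} (α ∷ β ∷ γ ∷ δ ∷ s) sorted p large with ∈-resp-↭ p (here refl) | sorted
    ... | here refl | _ = W-tail (drop-∷ p) large
    ... | there (here refl) | (α≤β ∷ _ ∷ α≤δ ∷ _) ∷ (β≤γ ∷ _) ∷ (γ≤δ ∷ _) ∷ _ = begin
      W (β ∷ L)             ≈⟨ W-tail (drop-∷ p′) large ⟩
      W (β ∷ δ ∷ γ ∷ α ∷ s) ≈⟨ W-ends β≤γ γ≤δ (Large-resp-↭ p′ large) ⟩
      W (δ ∷ β ∷ γ ∷ α ∷ s) ≈⟨ W-tail βγα↭αβγ (Large-resp-↭ p″ large) ⟩
      W (δ ∷ α ∷ β ∷ γ ∷ s) ≈⟨ W-ends α≤β (≤-trans β≤γ γ≤δ) (Large-resp-↭ q large) ⟨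
      W (α ∷ δ ∷ β ∷ γ ∷ s) ≈⟨ W-tail δβγ↭βγδ (Large-resp-↭ q large) ⟩
      W (α ∷ β ∷ γ ∷ δ ∷ s) ∎
      where
      δβγ↭βγδ : δ ∷ β ∷ γ ∷ s ↭ β ∷ γ ∷ δ ∷ s
      δβγ↭βγδ = ↭-sym (shift δ (β ∷ γ ∷ []) s)
      βγα↭αβγ : β ∷ γ ∷ α ∷ s ↭ α ∷ β ∷ γ ∷ s
      βγα↭αβγ = shift α (β ∷ γ ∷ []) s
      q : t ∷ L ↭ α ∷ δ ∷ β ∷ γ ∷ s
      q = ↭-trans p (prep α (↭-sym δβγ↭βγδ))
      p″ : t ∷ L ↭ δ ∷ β ∷ γ ∷ α ∷ s
      p″ = ↭-trans q (↭-trans (swap α δ ↭-refl) (prep δ (↭-sym βγα↭αβγ)))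
      p′ : t ∷ L ↭ β ∷ δ ∷ γ ∷ α ∷ s
      p′ = ↭-trans p″ (swap δ β ↭-refl)
    ... | there (there t∈) | (α≤β ∷ _) ∷ β≤ ∷ _ with ys , zs , eq ← ∈-∃++ t∈ = begin
      W (t ∷ L)                 ≈⟨ W-tail (drop-∷ p′) large ⟩
      W (t ∷ α ∷ β ∷ ys ++ zs)  ≈⟨ W-ends α≤β (All.lookup β≤ t∈) (Large-resp-↭ q large) ⟨
      W (α ∷ t ∷ β ∷ ys ++ zs)
        ≈⟨ W-tail (↭-trans (↭-sym q₁) (↭-reflexive (cong (β ∷_) (sym eq)))) (Large-resp-↭ q large) ⟩
      W (α ∷ β ∷ γ ∷ δ ∷ s)     ∎
      where
      q₁ : β ∷ ys ++ t ∷ zs ↭ t ∷ β ∷ ys ++ zs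
      q₁ = shift t (β ∷ ys) zs
      q : t ∷ L ↭ α ∷ t ∷ β ∷ ys ++ zs
      q = ↭-trans p (prep α (↭-trans (↭-reflexive (cong (β ∷_) eq)) q₁))
      p′ : t ∷ L ↭ t ∷ α ∷ β ∷ ys ++ zs
      p′ = ↭-trans q (swap α t ↭-refl)
    W-least [] _ p (_ , len , _) with () ← ↭-length p
    W-least (_ ∷ []) _ p (_ , len , _) with s≤s () ← subst (3 <_) (↭-length p) len
    W-least (_ ∷ _ ∷ []) _ p (_ , len , _) with s≤s (s≤s ()) ← subst (3 <_) (↭-length p) len
    W-least (_ ∷ _ ∷ _ ∷ []) _ p (_ , len , _)
      with s≤s (s≤s (s≤s ())) ← subst (3 <_) (↭-length p) len

  rearrange-odd : x ∷ L₁ ↭ y ∷ L₂ → v ∷ V ≼ x ∷ L₁ → 2 < length L₁ → suc (length V) < length L₁ →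
    x ∷ (v ∷ V) ⋈ L₁ ≈ y ∷ (v ∷ V) ⋈ L₂
  rearrange-odd {x} {L₁} {y} {L₂} p V≼ len len′ = begin
    W (x ∷ L₁)        ≈⟨ W-least (sort (x ∷ L₁)) sorted (↭-sym (sort-↭ _)) large ⟩
    W (sort (x ∷ L₁))
      ≈⟨ W-least (sort (x ∷ L₁)) sorted (↭-sym (↭-trans (sort-↭ _) p)) (Large-resp-↭ p large) ⟨
    W (y ∷ L₂)        ∎
    where
    sorted : AllPairs _≤_ (sort (x ∷ L₁))
    sorted = Linked⇒AllPairs ≤-trans (sort-↗ (x ∷ L₁))
    large : Large (x ∷ L₁)
    large = V≼ , s≤s len , s≤s len′


-- Standard words

-- The shape of the two arguments of an interleaving, written V and L, in standard words.
record Spread (V L : List ℕ) : Set where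
  constructor spread
  field
    decreasing : AllPairs _≥_ V
    below      : V ≼ L
    shorter    : length V < length L

-- Words equivalent to an interleaving, possibly preceded by one letter t.  The names of
-- the constructors refer to the parity of the positions of v ∷ V, counted from 0.
data Standard (w : List ℕ) : Set where
  even : ∀ v V L → Spread (v ∷ V) L → w ≈ (v ∷ V) ⋈ L → Standard w
  odd  : ∀ t v V L → All (_≤ t) (v ∷ V) → Spread (v ∷ V) L → w ≈ t ∷ (v ∷ V) ⋈ L → Standard w

Standard-resp-≈ : w ≈ w′ → Standard w′ → Standard w
Standard-resp-≈ e (even v V L sp f)     = even v V L sp (≈-trans e f)
Standard-resp-≈ e (odd t v V L V≤ sp f) = odd t v V L V≤ sp (≈-trans e f)

standard-min : All (a ≤_) L → 2 ≤ length L → Standard (a ∷ L)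
standard-min {a} {L} a≤L len =
  even a [] L (spread ([] ∷ []) (a≤L ∷ []) len) (≈-reflexive (sym (⋈-singleton L)))

-- The result of moving a (followed by T) through a ∷ T ++ V ⋈ L: only letters
-- at most a remain in the first argument.  If none remains, a is smallest.
record Sunk (a : ℕ) (T V L : List ℕ) : Set where
  constructor sunk
  field
    {V′ L′} : List ℕ
    equiv   : a ∷ T ++ V ⋈ L ≈ a ∷ T ++ V′ ⋈ L′
    V′≤a    : All (_≤ a) V′
    isSpread : Spread V′ L′
    longer  : length L ≤ length L′
    minimal : V′ ≡ [] → All (a ≤_) L′

pair-to-front : ∀ T v x → All (a ≤_) T → a ≤ v → v ≤ x → a ∷ T ++ v ∷ x ∷ s ≈ x ∷ v ∷ a ∷ T ++ s
pair-to-front {a} {s} T v x a≤T a≤v v≤x = begin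
  a ∷ T ++ v ∷ x ∷ s          ≡⟨ cong (a ∷_) (++-assoc T (v ∷ x ∷ []) s) ⟨
  a ∷ (T ++ v ∷ x ∷ []) ++ s  ≈⟨ rearrange-after-min (++-comm T (v ∷ x ∷ []))
                                   (++⁺ a≤T (a≤v ∷ ≤-trans a≤v v≤x ∷ [])) ⟩
  a ∷ v ∷ x ∷ T ++ s          ≈⟨ reversal a≤v v≤x ⟩
  x ∷ v ∷ a ∷ T ++ s          ∎

pair-past : ∀ T v x → All (a ≤_) T → a ≤ v → v ≤ x → x ∷ v ∷ a ∷ T ++ s ≈ a ∷ T ++ x ∷ v ∷ s
pair-past {a} {s} T v x a≤T a≤v v≤x = begin
  x ∷ v ∷ a ∷ T ++ s          ≈⟨ hop a≤v v≤x ⟨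
  a ∷ x ∷ v ∷ T ++ s          ≈⟨ rearrange-after-min (++-comm (x ∷ v ∷ []) T)
                                   (≤-trans a≤v v≤x ∷ a≤v ∷ a≤T) ⟩
  a ∷ (T ++ x ∷ v ∷ []) ++ s  ≡⟨ cong (a ∷_) (++-assoc T (x ∷ v ∷ []) s) ⟩
  a ∷ T ++ x ∷ v ∷ s          ∎

-- Used for T with at most one letter, where a ∷ T ++ V ⋈ L is a letter in front of a
-- standard word.  If v ≥ a, the pair v, x passes a and is absorbed after the recursion.
sink : ∀ V L → All (a ≤_) T → Spread V L → (V ≡ [] → All (a ≤_) L) → Sunk a T V L
sink [] L _ sp min = sunk ≈-refl [] sp ≤-refl min
sink {a} {T} (v ∷ V) L a≤T sp min with ≤-total v a
sink {a} {T} (v ∷ V) L a≤T sp@(spread (v≥V ∷ _) _ _) min | inj₁ v≤a =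
  sunk ≈-refl (v≤a ∷ below-trans v≥V v≤a) sp ≤-refl λ ()
sink {a} {T} (v ∷ V) (x ∷ L) a≤T (spread (_ ∷ V↘) ((v≤x ∷ v≤L) ∷ V≼) len) min | inj₂ a≤v
  with sunk {V′} {L′} e V′≤a (spread V′↘ V′≼ len′) L≤L′ min′
         ← sink V L a≤T (spread V↘ (≼-tail V≼) (s≤s⁻¹ len)) (λ _ → All.map (≤-trans a≤v) v≤L)
  = sunk equiv V′≤a (spread V′↘ V′≼xvL′ (m≤n⇒m≤1+n (m≤n⇒m≤1+n len′))) (s≤s (m≤n⇒m≤1+n L≤L′)) minimal
  where
  V′≤v : All (_≤ v) V′
  V′≤v = below-trans V′≤a a≤v
  V′≼xvL′ : V′ ≼ x ∷ v ∷ L′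
  V′≼xvL′ = ≼-cons (below-trans V′≤v v≤x) (≼-cons V′≤v V′≼)
  minimal : V′ ≡ [] → All (a ≤_) (x ∷ v ∷ L′)
  minimal eq = ≤-trans a≤v v≤x ∷ a≤v ∷ min′ eq
  equiv : a ∷ T ++ v ∷ x ∷ V ⋈ L ≈ a ∷ T ++ V′ ⋈ x ∷ v ∷ L′
  equiv = begin
    a ∷ T ++ v ∷ x ∷ V ⋈ L    ≈⟨ pair-to-front T v x a≤T a≤v v≤x ⟩
    x ∷ v ∷ a ∷ T ++ V ⋈ L    ≈⟨ ∷⁺ x (∷⁺ v e) ⟩
    x ∷ v ∷ a ∷ T ++ V′ ⋈ L′  ≈⟨ pair-past T v x a≤T a≤v v≤x ⟩
    a ∷ T ++ x ∷ v ∷ V′ ⋈ L′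
      ≈⟨ ∷⁺ a (prefix⁺ T (absorb V′ x v V′≼xvL′ v≤x (m≤n⇒m≤1+n (<⇒≤ len′)))) ⟨
    a ∷ T ++ V′ ⋈ x ∷ v ∷ L′  ∎

-- If a is at most all of L, the word is already an interleaving of a ∷ v ∷ V and t ∷ L.
-- Otherwise L has a letter l < a; it is brought behind a, and the pair a, l is absorbed.
standard-odd : a ≤ t → All (_≤ a) (v ∷ V) → Spread (v ∷ V) L → Standard (a ∷ t ∷ (v ∷ V) ⋈ L)
standard-odd {a} {t} {v} {V} {L} a≤t V≤a sp@(spread V↘ V≼ len) with all? (a ≤?_) L
... | yes a≤L = even a (v ∷ V) (t ∷ L)
      (spread (V≤a ∷ V↘) ((a≤t ∷ a≤L) ∷ ≼-cons (below-trans V≤a a≤t) V≼) (s≤s len)) ≈-refl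
... | no a≰L
  with ℓ , ℓ∈L , a≰ℓ ← find (¬All⇒Any¬ (a ≤?_) L a≰L)
  with ys , zs , refl ← ∈-∃++ ℓ∈L
  = Standard-resp-≈ (∷⁺ a (∷⁺ t (rearrange v V p V≼ len)))
    (small-letter (ys ++ zs) (≼-resp-↭ p V≼) (subst (_ <_) (↭-length p) len))
  where
  p : ys ++ ℓ ∷ zs ↭ ℓ ∷ ys ++ zs
  p = shift ℓ ys zs
  V≤t : All (_≤ t) (v ∷ V)
  V≤t = below-trans V≤a a≤t

  -- A window of t, c, l (with c and t exchanged first if t ≤ c) brings l behind a.
  descend : ∀ {l c M} → l ≤ a → l ≤ c → v ∷ V ≼ c ∷ l ∷ M → length V < suc (length M) →
    Standard (a ∷ t ∷ (v ∷ V) ⋈ c ∷ l ∷ M)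
  descend {l} {c} {M} l≤a l≤c V≼ len with len+2 ← m≤n⇒m≤1+n (m≤n⇒m≤1+n len) | ≤-total c t
  ... | inj₁ c≤t = even v V (a ∷ l ∷ t ∷ c ∷ M)
        (spread V↘ V≼altcM (s≤s len+2)) (begin
    a ∷ t ∷ (v ∷ V) ⋈ c ∷ l ∷ M ≈⟨ ∷⁺ a (∷⁺ t (absorb (v ∷ V) c l V≼ l≤c len)) ⟩
    a ∷ t ∷ c ∷ l ∷ (v ∷ V) ⋈ M ≈⟨ ∷⁺ a (reversal l≤c c≤t) ⟨
    a ∷ l ∷ c ∷ t ∷ (v ∷ V) ⋈ M ≈⟨ ∷⁺ a (flip-tail l≤c c≤t) ⟩
    a ∷ l ∷ t ∷ c ∷ (v ∷ V) ⋈ M ≈⟨ ∷⁺ a (∷⁺ l (absorb (v ∷ V) t c (≼-tail (≼-tail V≼altcM)) c≤t len)) ⟨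
    a ∷ l ∷ (v ∷ V) ⋈ t ∷ c ∷ M ≈⟨ absorb (v ∷ V) a l V≼altcM l≤a len+2 ⟨
    (v ∷ V) ⋈ a ∷ l ∷ t ∷ c ∷ M ∎)
    where
    V≼altcM = ≼-cons V≤a (≼-cons (≼-head (≼-tail V≼))
                (≼-cons V≤t (≼-cons (≼-head V≼) (≼-tail (≼-tail V≼)))))
  ... | inj₂ t≤c = even v V (a ∷ l ∷ c ∷ t ∷ M)
        (spread V↘ V≼alctM (s≤s len+2)) (begin
    a ∷ t ∷ (v ∷ V) ⋈ c ∷ l ∷ M ≈⟨ ∷⁺ a (∷⁺ t (absorb (v ∷ V) c l V≼ l≤c len)) ⟩
    a ∷ t ∷ c ∷ l ∷ (v ∷ V) ⋈ M ≈⟨ flip-tail a≤t t≤c ⟩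
    a ∷ c ∷ t ∷ l ∷ (v ∷ V) ⋈ M ≈⟨ ∷⁺ a (reversal (≤-trans l≤a a≤t) t≤c) ⟨
    a ∷ l ∷ t ∷ c ∷ (v ∷ V) ⋈ M ≈⟨ ∷⁺ a (flip-tail (≤-trans l≤a a≤t) t≤c) ⟩
    a ∷ l ∷ c ∷ t ∷ (v ∷ V) ⋈ M ≈⟨ ∷⁺ a (∷⁺ l (absorb (v ∷ V) c t (≼-tail (≼-tail V≼alctM)) t≤c len)) ⟨
    a ∷ l ∷ (v ∷ V) ⋈ c ∷ t ∷ M ≈⟨ absorb (v ∷ V) a l V≼alctM l≤a len+2 ⟨
    (v ∷ V) ⋈ a ∷ l ∷ c ∷ t ∷ M ∎)
    where
    V≼alctM = ≼-cons V≤a (≼-cons (≼-head (≼-tail V≼))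
                (≼-cons (≼-head V≼) (≼-cons V≤t (≼-tail (≼-tail V≼)))))

  small-letter : ∀ M → v ∷ V ≼ ℓ ∷ M → suc (length V) < suc (length M) →
    Standard (a ∷ t ∷ (v ∷ V) ⋈ ℓ ∷ M)
  small-letter [] _ (s≤s ())
  small-letter (c ∷ M) V≼ len with ≤-total c ℓ
  ... | inj₁ c≤ℓ = descend (≤-trans c≤ℓ (≰⇒≥ a≰ℓ)) c≤ℓ V≼ (s≤s⁻¹ len)
  ... | inj₂ ℓ≤c = Standard-resp-≈ (∷⁺ a (∷⁺ t (rearrange v V ℓc↭cℓ V≼ len)))
        (descend (≰⇒≥ a≰ℓ) ℓ≤c (≼-resp-↭ ℓc↭cℓ V≼) (s≤s⁻¹ len))
    where
    ℓc↭cℓ : ℓ ∷ c ∷ M ↭ c ∷ ℓ ∷ M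
    ℓc↭cℓ = swap ℓ c ↭-refl

-- If a exceeds all v's and t, the pair a, t is absorbed; otherwise a sinks.
standard-∷ : ∀ a → Standard w → Standard (a ∷ w)
standard-∷ a (even v V L sp@(spread _ _ len) e)
  with sink {a} {[]} (v ∷ V) L [] sp (λ ())
... | sunk {[]} {L′} f _ _ L≤L′ min = Standard-resp-≈ (≈-trans (∷⁺ a e) f)
      (standard-min (min refl) (≤-trans (s≤s (s≤s z≤n)) (≤-trans len L≤L′)))
... | sunk {v′ ∷ V′} {L′} f V′≤a sp′ _ _ = odd a v′ V′ L′ V′≤a sp′ (≈-trans (∷⁺ a e) f)
standard-∷ a (odd t v V L V≤t sp@(spread V↘ V≼ len) e) with ≤-total a t
... | inj₂ t≤a = even v V (a ∷ t ∷ L)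
      (spread V↘ V≼atL (m≤n⇒m≤1+n (m≤n⇒m≤1+n len)))
      (≈-trans (∷⁺ a e) (≈-sym (absorb (v ∷ V) a t V≼atL t≤a (m≤n⇒m≤1+n (<⇒≤ len)))))
  where
  V≼atL : v ∷ V ≼ a ∷ t ∷ L
  V≼atL = ≼-cons (below-trans V≤t t≤a) (≼-cons V≤t V≼)
... | inj₁ a≤t with sink {a} {t ∷ []} (v ∷ V) L (a≤t ∷ []) sp (λ ())
...   | sunk {[]} {L′} f _ _ L≤L′ min = Standard-resp-≈ (≈-trans (∷⁺ a e) f)
        (standard-min (a≤t ∷ min refl) (≤-trans (s≤s (s≤s z≤n)) (m≤n⇒m≤1+n (≤-trans len L≤L′))))
...   | sunk {v′ ∷ V′} {L′} f V′≤a sp′ _ _ =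
        Standard-resp-≈ (≈-trans (∷⁺ a e) f) (standard-odd a≤t V′≤a sp′)

-- Movable words are standard

-- The windows that admit a move in one of the two directions.
data Bad (a b c : ℕ) : Set where
  min-first  : a ≤ b → a ≤ c → Bad a b c
  decreasing : c ≤ b → b ≤ a → Bad a b c

-- Words with such a window.
data Movable : List ℕ → Set where
  here  : Bad a b c → Movable (a ∷ b ∷ c ∷ s)
  there : Movable w → Movable (x ∷ w)

-- The bound n on the length serves as the measure of the recursion, as the tail is
-- rearranged before the recursive call.
standardise : ∀ n w → length w ≤ n → Movable w → Standard w
standardise (suc n) (x ∷ w) (s≤s len) (there m) = standard-∷ x (standardise n w len m)
standardise (suc n) (a ∷ b ∷ c ∷ s) (s≤s len) (here bad) = case bad of λ where
    (min-first a≤b a≤c)  → least-first s a b c len a≤b a≤c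
    (decreasing c≤b b≤a) → Standard-resp-≈ (≈-sym (reversal c≤b b≤a))
                             (least-first s c b a len c≤b (≤-trans c≤b b≤a))
  where
  -- In both auxiliary functions, the word is rearranged so that the smallest of the letters
  -- b, c, d starts a window in the tail.
  fourth-first : ∀ s a b c d → suc (suc (suc (length s))) ≤ n →
    a ≤ b → a ≤ c → a ≤ d → d ≤ b → d ≤ c → Standard (a ∷ b ∷ c ∷ d ∷ s)
  fourth-first s a b c d len a≤b a≤c a≤d d≤b d≤c =
    Standard-resp-≈ (≈-trans (swap₂ b c d a≤b a≤c a≤d) (swap₁ b d a≤b a≤d))
      (standard-∷ a (standardise n (d ∷ b ∷ c ∷ s) len (here (min-first d≤b d≤c))))

  least-first : ∀ s a b c → suc (suc (length s)) ≤ n → a ≤ b → a ≤ c → Standard (a ∷ b ∷ c ∷ s)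
  least-first [] a b c len a≤b a≤c = standard-min (a≤b ∷ a≤c ∷ []) ≤-refl
  least-first (d ∷ s) a b c len a≤b a≤c with ≤-total d a
  least-first (d ∷ s) a b c len a≤b a≤c | inj₁ d≤a with ≤-total b c
  ... | inj₁ b≤c = Standard-resp-≈ e (standard-∷ a (standardise n (d ∷ b ∷ c ∷ s) len
                     (here (min-first (≤-trans d≤a a≤b) (≤-trans d≤a a≤c)))))
    where
    e : a ∷ b ∷ c ∷ d ∷ s ≈ a ∷ d ∷ b ∷ c ∷ s
    e = begin
      a ∷ b ∷ c ∷ d ∷ s ≈⟨ flip-tail a≤b b≤c ⟩
      a ∷ c ∷ b ∷ d ∷ s ≈⟨ ∷⁺ a (reversal (≤-trans d≤a a≤b) b≤c) ⟨
      a ∷ d ∷ b ∷ c ∷ s ∎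
  ... | inj₂ c≤b = Standard-resp-≈ e (standard-∷ a (standardise n (d ∷ c ∷ b ∷ s) len
                     (here (min-first (≤-trans d≤a a≤c) (≤-trans d≤a a≤b)))))
    where
    e : a ∷ b ∷ c ∷ d ∷ s ≈ a ∷ d ∷ c ∷ b ∷ s
    e = ∷⁺ a (≈-sym (reversal (≤-trans d≤a a≤c) c≤b))
  least-first (d ∷ s) a b c len a≤b a≤c | inj₂ a≤d with ≤-total b c | ≤-total b d | ≤-total c d
  ... | inj₁ b≤c | inj₁ b≤d | _ =
    standard-∷ a (standardise n (b ∷ c ∷ d ∷ s) len (here (min-first b≤c b≤d)))
  ... | inj₂ c≤b | _ | inj₁ c≤d = Standard-resp-≈ (swap₁ b c a≤b a≤c)
    (standard-∷ a (standardise n (c ∷ b ∷ d ∷ s) len (here (min-first c≤b c≤d))))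
  ... | inj₁ b≤c | inj₂ d≤b | _ = fourth-first s a b c d len a≤b a≤c a≤d d≤b (≤-trans d≤b b≤c)
  ... | inj₂ c≤b | _ | inj₂ d≤c = fourth-first s a b c d len a≤b a≤c a≤d (≤-trans d≤c c≤b) d≤c

bad? : ∀ a b c → Dec (Bad a b c)
bad? a b c = map′ (λ { (inj₁ (p , q)) → min-first p q ; (inj₂ (p , q)) → decreasing p q })
                  (λ { (min-first p q) → inj₁ (p , q) ; (decreasing p q) → inj₂ (p , q) })
                  ((a ≤? b ×-dec a ≤? c) ⊎-dec (c ≤? b ×-dec b ≤? a))

movable? : ∀ w → Dec (Movable w)
movable? []              = no λ ()
movable? (_ ∷ [])        = no λ { (there ()) }
movable? (_ ∷ _ ∷ [])    = no λ { (there (there ())) }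
movable? (a ∷ b ∷ c ∷ s) =
  map′ (λ { (inj₁ p) → here p ; (inj₂ m) → there m })
       (λ { (here p) → inj₁ p ; (there m) → inj₂ m })
       (bad? a b c ⊎-dec movable? (b ∷ c ∷ s))

⟶-movable : w ⟶ w′ → Movable w × Movable w′
⟶-movable (123→132 a≤b b≤c) =
  here (min-first a≤b (≤-trans a≤b b≤c)) , here (min-first (≤-trans a≤b b≤c) a≤b)
⟶-movable (123→321 a≤b b≤c) =
  here (min-first a≤b (≤-trans a≤b b≤c)) , here (decreasing a≤b b≤c)
⟶-movable (there st) with m , m′ ← ⟶-movable st = there m , there m′

immovable-alone : ¬ Movable w → w ≈ w′ → w ≡ w′
immovable-alone _ ε            = refl
immovable-alone ¬m (fwd st ◅ _) = ⊥-elim (¬m (proj₁ (⟶-movable st)))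
immovable-alone ¬m (bwd st ◅ _) = ⊥-elim (¬m (proj₂ (⟶-movable st)))

immovable≉movable : ¬ Movable w → Movable w′ → ¬ w ≈ w′
immovable≉movable ¬m m f = ¬m (subst Movable (sym (immovable-alone ¬m f)) m)

movable-⋈ : ∀ v V {L} → v ∷ V ≼ L → suc (length V) < length L → Movable ((v ∷ V) ⋈ L)
movable-⋈ v [] {_ ∷ _ ∷ _} ((v≤x ∷ v≤y ∷ _) ∷ []) _ = here (min-first v≤x v≤y)
movable-⋈ v [] {[]} _ ()
movable-⋈ v [] {_ ∷ []} _ (s≤s ())
movable-⋈ v (u ∷ V) {x ∷ L} (_ ∷ V≼) len = there (there (movable-⋈ u V (≼-tail V≼) (s≤s⁻¹ len)))

⟶-↭ : w ⟶ w′ → w ↭ w′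
⟶-↭ (123→132 {a = a} {b = b} {c = c} _ _) = prep a (swap b c ↭-refl)
⟶-↭ (123→321 {a = a} {b = b} {c = c} _ _) =
  ↭-trans (swap a b ↭-refl) (↭-trans (prep b (swap a c ↭-refl)) (swap b c ↭-refl))
⟶-↭ (there {x = x} st) = prep x (⟶-↭ st)

≈-↭ : w ≈ w′ → w ↭ w′
≈-↭ = EqClosure.fold ↭.↭-isEquivalence ⟶-↭

-- Canonical words

-- The r letters k, k + 1, ....
upFrom : ℕ → ∀ r → Vec ℕ r
upFrom k zero    = []
upFrom k (suc r) = k ∷ upFrom (suc k) r

-- The letters m, ..., 1.
countdown : ℕ → List ℕ
countdown zero    = []
countdown (suc m) = suc m ∷ countdown m

-- The letters 1, ..., n.
letters : ℕ → List ℕ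
letters n = toList (upFrom 1 n)

-- The representatives of the classes of movable permutations.  There are suc m small
-- letters; the large letters are in increasing order; e tells whether a letter precedes
-- the interleaving, and equals the parity of the positions of the small letters.
canonical : Bool → ℕ → ℕ → List ℕ
canonical false m r = countdown (suc m) ⋈ toList (upFrom (2 + m) r)
canonical true  m r = 2 + m ∷ countdown (suc m) ⋈ toList (upFrom (3 + m) r)

-- The number of letters of a canonical word.
size : Bool → ℕ → ℕ → ℕ
size false m r = suc m + r
size true  m r = 2 + m + r

upFrom-≥ : ∀ k r → All (k ≤_) (toList (upFrom k r))
upFrom-≥ k zero    = []
upFrom-≥ k (suc r) = ≤-refl ∷ All.map <⇒≤ (upFrom-≥ (suc k) r)

upFrom-< : ∀ k r → AllPairs _<_ (toList (upFrom k r))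
upFrom-< k zero    = []
upFrom-< k (suc r) = upFrom-≥ (suc k) r ∷ upFrom-< (suc k) r

countdown-≤ : ∀ m → All (_≤ m) (countdown m)
countdown-≤ zero    = []
countdown-≤ (suc m) = ≤-refl ∷ All.map m≤n⇒m≤1+n (countdown-≤ m)

countdown-> : ∀ m → AllPairs (λ x y → y < x) (countdown m)
countdown-> zero    = []
countdown-> (suc m) = All.map s≤s (countdown-≤ m) ∷ countdown-> m

length-countdown : ∀ m → length (countdown m) ≡ m
length-countdown zero    = refl
length-countdown (suc m) = cong suc (length-countdown m)

countdown-upFrom : ∀ m r → countdown m ʳ++ toList (upFrom (suc m) r) ≡ letters (m + r)
countdown-upFrom zero    r = refl
countdown-upFrom (suc m) r = trans (countdown-upFrom m (suc r)) (cong letters (+-suc m r))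

countdown-≼ : ∀ m k r → m ≤ k → countdown m ≼ toList (upFrom k r)
countdown-≼ m k r m≤k =
  All.map (λ v≤m → All.map (≤-trans (≤-trans v≤m m≤k)) (upFrom-≥ k r)) (countdown-≤ m)

⋈-↭ : ∀ V L → V ⋈ L ↭ V ++ L
⋈-↭ []      L       = ↭-refl
⋈-↭ (v ∷ V) []      = ↭-reflexive (sym (++-identityʳ (v ∷ V)))
⋈-↭ (v ∷ V) (x ∷ L) = prep v (↭-trans (prep x (⋈-↭ V L)) (↭-sym (shift x V L)))

ascending-unique : AllPairs _≤_ L₁ → AllPairs _≤_ L₂ → L₁ ↭ L₂ → L₁ ≡ L₂
ascending-unique {[]} {[]} _ _ _ = refl
ascending-unique {[]} {_ ∷ _} _ _ p with () ← ↭-length p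
ascending-unique {_ ∷ _} {[]} _ _ p with () ← ↭-length p
ascending-unique {x ∷ L₁} {y ∷ L₂} (x≤ ∷ L₁↗) (y≤ ∷ L₂↗) p with x≡y
  where
  x≤all : All (x ≤_) (y ∷ L₂)
  x≤all = All-resp-↭ p (≤-refl ∷ x≤)
  y≤all : All (y ≤_) (x ∷ L₁)
  y≤all = All-resp-↭ (↭-sym p) (≤-refl ∷ y≤)
  x≡y : x ≡ y
  x≡y = ≤-antisym (All.head x≤all) (All.head y≤all)
... | refl = cong (x ∷_) (ascending-unique L₁↗ L₂↗ (drop-∷ p))

ʳ++-ascending : AllPairs _≥_ V → V ≼ L → AllPairs _≤_ L → AllPairs _≤_ (V ʳ++ L)
ʳ++-ascending []         []         L↗ = L↗
ʳ++-ascending (V≤v ∷ V↘) (v≤L ∷ V≼) L↗ = ʳ++-ascending V↘ (≼-cons V≤v V≼) (v≤L ∷ L↗)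

ʳ++-injective : ∀ V V′ → length V ≡ length V′ → V ʳ++ L₁ ≡ V′ ʳ++ L₂ → V ≡ V′ × L₁ ≡ L₂
ʳ++-injective []      []        _  eq = refl , eq
ʳ++-injective (_ ∷ V) (_ ∷ V′) len eq with refl , eq′ ← ʳ++-injective V V′ (suc-injective len) eq
  with refl , eq″ ← ∷-injective eq′ = refl , eq″

-- Reversing V in front of the sorted letters of L yields the sorted list of all letters.
smallest-letters : AllPairs _≥_ V → V ≼ L → V ++ L ↭ letters n →
  n ≡ length V + length L ×
  V ≡ countdown (length V) ×
  L ↭ toList (upFrom (suc (length V)) (length L))
smallest-letters {V} {L} {n} V↘ V≼L p =
  n≡ , proj₁ V≡ , ↭-trans (↭-sym (sort-↭ L)) (↭-reflexive (proj₂ V≡))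
  where
  n≡ : n ≡ length V + length L
  n≡ = trans (sym (length-toList (upFrom 1 n))) (trans (sym (↭-length p)) (length-++ V))
  q : V ʳ++ sort L ↭ letters n
  q = ↭-trans (↭-sym (++↭ʳ++ V (sort L))) (↭-trans (++⁺ˡ V (sort-↭ L)) p)
  eq : V ʳ++ sort L ≡ letters n
  eq = ascending-unique
         (ʳ++-ascending V↘ (≼-resp-↭ (↭-sym (sort-↭ L)) V≼L) (Linked⇒AllPairs ≤-trans (sort-↗ L)))
         (AllPairs.map <⇒≤ (upFrom-< 1 n)) q
  V≡ : V ≡ countdown (length V) × sort L ≡ toList (upFrom (suc (length V)) (length L))
  V≡ = ʳ++-injective V (countdown (length V)) (sym (length-countdown (length V)))
         (trans eq (trans (cong letters n≡) (sym (countdown-upFrom (length V) (length L)))))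

-- The hypothesis of `rearrange-odd` on the number of letters; it fails for n = 4, where m = 0
-- and r = 2.
three-large : ∀ {m r} → 5 ≤ n → n ≡ suc m + suc r → suc m < r → 2 < r
three-large {r = suc (suc (suc _))} _ _ _ = s≤s (s≤s (s≤s z≤n))
three-large {r = suc zero}       _ _ (s≤s ())
three-large {m = suc _} {suc (suc zero)} _ _ (s≤s (s≤s ()))
three-large {m = zero} {suc (suc zero)} (s≤s (s≤s (s≤s (s≤s ())))) refl _

canonical-form : 5 ≤ n → w ↭ letters n → Standard w →
  ∃₂ λ e m → ∃ λ r → n ≡ size e m r × suc m < r × w ≈ canonical e m r
canonical-form {n} {w} 5≤n p (even v V L (spread V↘ V≼ len) f)
  with n≡ , V≡ , q ← smallest-letters V↘ V≼
         (↭-trans (↭-sym (⋈-↭ (v ∷ V) L)) (↭-trans (↭-sym (≈-↭ f)) p))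
  = false , length V , length L , n≡ , len , (begin
      w                                  ≈⟨ f ⟩
      (v ∷ V) ⋈ L                        ≈⟨ rearrange v V q V≼ len ⟩
      (v ∷ V) ⋈ toList (upFrom (2 + length V) (length L))
        ≡⟨ cong (_⋈ toList (upFrom (2 + length V) (length L))) V≡ ⟩
      canonical false (length V) (length L) ∎)
canonical-form {n} {w} 5≤n p (odd t v V L V≤t (spread V↘ V≼ len) f)
  with n≡ , V≡ , q ← smallest-letters V↘ (≼-cons V≤t V≼)
         (↭-trans (shift t (v ∷ V) L) (↭-trans (prep t (↭-sym (⋈-↭ (v ∷ V) L)))
           (↭-trans (↭-sym (≈-↭ f)) p)))
  = true , length V , length L , trans n≡ (+-suc (suc (length V)) (length L)) , len , (begin
      w                    ≈⟨ f ⟩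
      t ∷ (v ∷ V) ⋈ L      ≈⟨ rearrange-odd v V q (≼-cons V≤t V≼) (three-large 5≤n n≡ len) len ⟩
      2 + length V ∷ (v ∷ V) ⋈ toList (upFrom (3 + length V) (length L))
        ≡⟨ cong (λ U → 2 + length V ∷ U ⋈ toList (upFrom (3 + length V) (length L))) V≡ ⟩
      canonical true (length V) (length L) ∎)

-- The invariant that separates canonical words

-- A list with x in front if P holds.  Unlike a definition by `if`, this keeps the decision
-- available for case distinctions.
keep : ∀ {A P : Set} → Dec P → A → List A → List A
keep (yes _) x xs = x ∷ xs
keep (no _)  x xs = xs

keep-yes : ∀ {A P : Set} {x : A} {xs} (d : Dec P) → P → keep d x xs ≡ x ∷ xs
keep-yes (yes _) _ = refl
keep-yes (no ¬p) p = ⊥-elim (¬p p)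

keep-no : ∀ {A P : Set} {x : A} {xs} (d : Dec P) → ¬ P → keep d x xs ≡ xs
keep-no (yes p) ¬p = ⊥-elim (¬p p)
keep-no (no _)  _  = refl

-- The letters of w that are at most j, each with the parity of its position, where p is
-- the parity of the first position.
tagged : ℕ → Bool → List ℕ → List (ℕ × Bool)
tagged j p []      = []
tagged j p (x ∷ w) = keep (x ≤? j) (x , p) (tagged j (not p) w)

-- Decreasing letters on positions of the same parity.
Falling : List (ℕ × Bool) → Set
Falling = AllPairs λ (x , p) (y , q) → y < x × p ≡ q

p≢not-p : ∀ {p} → p ≢ not p
p≢not-p {true} ()
p≢not-p {false} ()

-- If b ≤ j, then a and b are tagged.  They are adjacent, or in increasing order in
-- acb, so the tags are not falling.  Hence a is the only letter of the
-- window that can be tagged, and it moves by 0 or 2 positions.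
tagged-⟶ : ∀ j p {w w′} → w ⟶ w′ → Falling (tagged j p w) → tagged j p w ≡ tagged j p w′
tagged-⟶ j p (there {x = x} st) f with x ≤? j
... | yes _ = cong ((x , p) ∷_) (tagged-⟶ j (not p) st (AllPairs.tail f))
... | no _  = tagged-⟶ j (not p) st f
tagged-⟶ j p (123→132 {a = a} {b = b} {c = c} a≤b b≤c) f with a ≤? j | b ≤? j | c ≤? j
... | no a≰j | yes b≤j | _ = ⊥-elim (a≰j (≤-trans a≤b b≤j))
... | yes _ | yes _ | _ with ((_ , eq) ∷ _) ∷ _ ← f = ⊥-elim (p≢not-p eq)
... | _ | no b≰j | yes c≤j = ⊥-elim (b≰j (≤-trans b≤c c≤j))
... | _ | no _ | no _ = refl
tagged-⟶ j p (123→321 {a = a} {b = b} {c = c} a≤b b≤c) f with a ≤? j | b ≤? j | c ≤? j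
... | no a≰j | yes b≤j | _ = ⊥-elim (a≰j (≤-trans a≤b b≤j))
... | yes _ | yes _ | _ with ((_ , eq) ∷ _) ∷ _ ← f = ⊥-elim (p≢not-p eq)
... | _ | no b≰j | yes c≤j = ⊥-elim (b≰j (≤-trans b≤c c≤j))
... | yes _ | no _ | no _ rewrite not-involutive p = refl
... | no _ | no _ | no _ = refl

tagged-⟵ : ∀ j p {w w′} → w ⟶ w′ → Falling (tagged j p w′) → tagged j p w ≡ tagged j p w′
tagged-⟵ j p (there {x = x} st) f with x ≤? j
... | yes _ = cong ((x , p) ∷_) (tagged-⟵ j (not p) st (AllPairs.tail f))
... | no _  = tagged-⟵ j (not p) st f
tagged-⟵ j p (123→132 {a = a} {b = b} {c = c} a≤b b≤c) f with a ≤? j | b ≤? j | c ≤? j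
... | no a≰j | yes b≤j | _ = ⊥-elim (a≰j (≤-trans a≤b b≤j))
... | yes _ | yes _ | yes _ with ((_ , eq) ∷ _) ∷ _ ← f = ⊥-elim (p≢not-p eq)
... | yes _ | yes _ | no _ with ((b<a , _) ∷ _) ∷ _ ← f = ⊥-elim (<⇒≱ b<a a≤b)
... | _ | no b≰j | yes c≤j = ⊥-elim (b≰j (≤-trans b≤c c≤j))
... | _ | no _ | no _ = refl
tagged-⟵ j p (123→321 {a = a} {b = b} {c = c} a≤b b≤c) f with a ≤? j | b ≤? j | c ≤? j
... | no a≰j | yes b≤j | _ = ⊥-elim (a≰j (≤-trans a≤b b≤j))
... | yes _ | yes _ | yes _ with ((_ , eq) ∷ _) ∷ _ ← f = ⊥-elim (p≢not-p eq)
... | yes _ | yes _ | no _ with ((_ , eq) ∷ _) ∷ _ ← f = ⊥-elim (p≢not-p eq)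
... | _ | no b≰j | yes c≤j = ⊥-elim (b≰j (≤-trans b≤c c≤j))
... | yes _ | no _ | no _ rewrite not-involutive p = refl
... | no _ | no _ | no _ = refl

tagged-≈ : ∀ j p {w w′} → w ≈ w′ → Falling (tagged j p w) → tagged j p w ≡ tagged j p w′
tagged-≈ j p ε             f = refl
tagged-≈ j p (fwd st ◅ e) f with eq ← tagged-⟶ j p st f =
  trans eq (tagged-≈ j p e (subst Falling eq f))
tagged-≈ j p (bwd st ◅ e) f with eq ← sym (tagged-⟵ j p st f) =
  trans eq (tagged-≈ j p e (subst Falling eq f))

tagged-large : ∀ j p → All (j <_) L → tagged j p L ≡ []
tagged-large j p []                = refl
tagged-large {x ∷ L} j p (j<x ∷ j<L) =
  trans (keep-no (x ≤? j) (<⇒≱ j<x)) (tagged-large j (not p) j<L)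

tagged-⋈ : ∀ j p V → All (_≤ j) V → All (j <_) L → length V ≤ length L →
  tagged j p (V ⋈ L) ≡ List.map (_, p) V
tagged-⋈ j p [] _ j<L _ = tagged-large j p j<L
tagged-⋈ {x ∷ L} j p (v ∷ V) (v≤j ∷ V≤j) (j<x ∷ j<L) (s≤s len) =
  trans (keep-yes (v ≤? j) v≤j) (cong ((v , p) ∷_)
    (trans (keep-no (x ≤? j) (<⇒≱ j<x))
      (trans (cong (λ q → tagged j q (V ⋈ L)) (not-involutive p)) (tagged-⋈ j p V V≤j j<L len))))

countdown-≤-upFrom : ∀ m k r → m ≤ r → length (countdown m) ≤ length (toList (upFrom k r))
countdown-≤-upFrom m k r m≤r rewrite length-countdown m | length-toList (upFrom k r) = m≤r

tagged-canonical : ∀ e m r → suc m < r →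
  tagged (suc m) false (canonical e m r) ≡ List.map (_, e) (countdown (suc m))
tagged-canonical false m r m<r = tagged-⋈ (suc m) false (countdown (suc m))
  (countdown-≤ (suc m)) (upFrom-≥ (2 + m) r) (countdown-≤-upFrom (suc m) (2 + m) r (<⇒≤ m<r))
tagged-canonical true  m r m<r =
  trans (keep-no (2 + m ≤? suc m) 1+n≰n) (tagged-⋈ (suc m) true (countdown (suc m))
    (countdown-≤ (suc m)) (All.map <⇒≤ (upFrom-≥ (3 + m) r))
    (countdown-≤-upFrom (suc m) (3 + m) r (<⇒≤ m<r)))

falling-countdown : ∀ e m → Falling (List.map (_, e) (countdown m))
falling-countdown e m = map⁺ (AllPairs.map (λ y<x → y<x , refl) (countdown-> m))

-- With j = suc m′, the tags of the second word are its small letters.  The small letter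
-- suc m of the first word is tagged with e, so e = e′.  If m < m′, the first word starts
-- with suc m at position 0, or with 2 + m at position 0 and suc m at position 1, while
-- its tags should start with suc m′ and have equal parities.
canonical-distinct-≤ : ∀ e m r e′ m′ r′ → suc m < r → suc m′ < r′ → m ≤ m′ →
  canonical e m r ≈ canonical e′ m′ r′ → e ≡ e′ × m ≡ m′
canonical-distinct-≤ e m r e′ m′ r′ m<r m′<r′ m≤m′ f
  = go e e′ r m<r eq
  where
  j = suc m′
  eq : List.map (_, e′) (countdown j) ≡ tagged j false (canonical e m r)
  eq = trans (sym (tagged-canonical e′ m′ r′ m′<r′)) (tagged-≈ j false (≈-sym f)
         (subst Falling (sym (tagged-canonical e′ m′ r′ m′<r′)) (falling-countdown e′ j)))
  go : ∀ e e′ r → suc m < r →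
    List.map (_, e′) (countdown j) ≡ tagged j false (canonical e m r) → e ≡ e′ × m ≡ m′
  go false e′ (suc r) m<r eq with ∷-injectiveˡ (trans eq (keep-yes (suc m ≤? j) (s≤s m≤m′)))
  ... | refl = refl , refl
  go true e′ (suc r) m<r eq with m≤n⇒m<n∨m≡n m≤m′
  ... | inj₂ refl
    with ∷-injectiveˡ (trans eq (trans (keep-no (2 + m ≤? suc m) 1+n≰n)
                                       (keep-yes (suc m ≤? suc m) ≤-refl)))
  ...   | refl = refl , refl
  go true e′ (suc r) m<r eq | inj₁ m<m′
    with refl ∷ () ∷ _ ← subst (All (λ (_ , q) → q ≡ e′))
      (trans eq (trans (keep-yes (2 + m ≤? j) (s≤s m<m′))
                       (cong ((2 + m , false) ∷_) (keep-yes (suc m ≤? j) (s≤s m≤m′)))))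
      (All-map⁺ (All.universal (λ _ → refl) (countdown j)))

canonical-distinct : ∀ e m r e′ m′ r′ → suc m < r → suc m′ < r′ →
  canonical e m r ≈ canonical e′ m′ r′ → e ≡ e′ × m ≡ m′
canonical-distinct e m r e′ m′ r′ m<r m′<r′ f with ≤-total m m′
... | inj₁ m≤m′ = canonical-distinct-≤ e m r e′ m′ r′ m<r m′<r′ m≤m′ f
... | inj₂ m′≤m with e≡ , m≡ ← canonical-distinct-≤ e′ m′ r′ e m r m′<r′ m<r m′≤m (≈-sym f)
  = sym e≡ , sym m≡

-- Immovable words

movable-++ˡ : ∀ p → Movable w → Movable (p ++ w)
movable-++ˡ []      m = m
movable-++ˡ (_ ∷ p) m = there (movable-++ˡ p m)

movable-++ʳ : ∀ s → Movable w → Movable (w ++ s)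
movable-++ʳ s (here bad) = here bad
movable-++ʳ s (there m)  = there (movable-++ʳ s m)

-- Appending a letter creates just one window.
movable-snoc : ∀ p → Movable (p ++ a ∷ b ∷ c ∷ []) → Movable (p ++ a ∷ b ∷ []) ⊎ Bad a b c
movable-snoc []              (here bad) = inj₂ bad
movable-snoc []              (there (there (there ())))
movable-snoc (_ ∷ [])        (here bad) = inj₁ (here bad)
movable-snoc (_ ∷ _ ∷ [])    (here bad) = inj₁ (here bad)
movable-snoc (_ ∷ _ ∷ _ ∷ _) (here bad) = inj₁ (here bad)
movable-snoc (_ ∷ p)         (there m)  with movable-snoc p m
... | inj₁ m′  = inj₁ (there m′)
... | inj₂ bad = inj₂ bad

-- Codes of the immovable words on m letters that remain immovable when a smaller letter is
-- appended: the last letter is chosen among the letters other than the smallest one,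
-- which precedes it, and the letters before them form a word of the same kind.
Code : ℕ → Set
Code zero          = ⊤
Code (suc zero)    = ⊤
Code (suc (suc m)) = Fin (suc m) × Code m

-- The word with a given code on the letters N, the first of which is the smallest.
spell : Vec ℕ m → Code m → List ℕ
spell []          _       = []
spell (x ∷ [])    _       = x ∷ []
spell (x ∷ y ∷ N) (i , c) = spell (removeAt (y ∷ N) i) c ++ x ∷ lookup (y ∷ N) i ∷ []

Code↔Fin : ∀ m → Code (suc m) ↔ Fin (m !!)
Code↔Fin zero          = ↔-sym 1↔⊤
Code↔Fin (suc zero)    = mk↔ₛ′ proj₁ (_, tt) (λ _ → refl) (λ _ → refl)
Code↔Fin (suc (suc m)) = ↔-sym *↔× ↔-∘ (↔-id _ ×-↔ Code↔Fin m)

removeAt-↭ : ∀ (N : Vec ℕ (suc m)) i → toList N ↭ lookup N i ∷ toList (removeAt N i)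
removeAt-↭ (x ∷ N)         zero    = ↭-refl
removeAt-↭ (x ∷ N@(_ ∷ _)) (suc i) =
  ↭-trans (prep x (removeAt-↭ N i)) (swap x (lookup N i) ↭-refl)

removeAt-All : ∀ {P : ℕ → Set} (N : Vec ℕ (suc m)) i →
  All P (toList N) → All P (toList (removeAt N i))
removeAt-All N i ps = All.tail (All-resp-↭ (removeAt-↭ N i) ps)

lookup-All : ∀ {P : ℕ → Set} (N : Vec ℕ (suc m)) i → All P (toList N) → P (lookup N i)
lookup-All N i ps = All.head (All-resp-↭ (removeAt-↭ N i) ps)

Ascending : Vec ℕ m → Set
Ascending N = AllPairs _<_ (toList N)

removeAt-ascending : ∀ (N : Vec ℕ (suc m)) i → Ascending N → Ascending (removeAt N i)
removeAt-ascending (x ∷ N)         zero    (_ ∷ N↗)   = N↗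
removeAt-ascending (x ∷ N@(_ ∷ _)) (suc i) (x< ∷ N↗) = removeAt-All N i x< ∷ removeAt-ascending N i N↗

lookup-injective : ∀ (N : Vec ℕ m) i j → Ascending N → lookup N i ≡ lookup N j → i ≡ j
lookup-injective (x ∷ N)         zero    zero    _ _ = refl
lookup-injective (x ∷ N@(_ ∷ _)) zero    (suc j) (x< ∷ _) eq =
  ⊥-elim (<⇒≢ (lookup-All N j x<) eq)
lookup-injective (x ∷ N@(_ ∷ _)) (suc i) zero    (x< ∷ _) eq =
  ⊥-elim (<⇒≢ (lookup-All N i x<) (sym eq))
lookup-injective (x ∷ N)         (suc i) (suc j) (_ ∷ N↗) eq = cong suc (lookup-injective N i j N↗ eq)

∈⇒lookup : ∀ (N : Vec ℕ m) → t ∈ toList N → ∃ λ i → lookup N i ≡ t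
∈⇒lookup (x ∷ N) (here refl) = zero , refl
∈⇒lookup (x ∷ N) (there t∈) with i , eq ← ∈⇒lookup N t∈ = suc i , eq

spell-↭ : ∀ (N : Vec ℕ m) c → spell N c ↭ toList N
spell-↭ []          _       = ↭-refl
spell-↭ (x ∷ [])    _       = ↭-refl
spell-↭ (x ∷ y ∷ N) (i , c) = ↭-trans (++-comm (spell (removeAt (y ∷ N) i) c) _)
  (prep x (↭-trans (prep _ (spell-↭ (removeAt (y ∷ N) i) c)) (↭-sym (removeAt-↭ (y ∷ N) i))))

-- The window q₋ x t, with q₋ the last letter of q, is harmless, as x is its minimum and lies
-- in the middle.
immovable-extend : ∀ q → All (x <_) q → x < t → z < x → ¬ Movable (q ++ x ∷ []) →
  ¬ Movable ((q ++ x ∷ t ∷ []) ++ z ∷ [])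
immovable-extend {x} {t} {z} q x<q x<t z<x ¬m m
  with movable-snoc q (subst Movable (++-assoc q (x ∷ t ∷ []) (z ∷ [])) m)
... | inj₂ (min-first _ x≤z)  = <⇒≱ z<x x≤z
... | inj₂ (decreasing _ t≤x) = <⇒≱ x<t t≤x
... | inj₁ m′ with initLast q
...   | [] with there (there ()) ← m′
...   | r ∷ʳ′ u with movable-snoc r (subst Movable (++-assoc r (u ∷ []) (x ∷ t ∷ [])) m′)
...     | inj₁ m″ = ¬m (subst Movable (sym (++-assoc r (u ∷ []) (x ∷ []))) m″)
...     | inj₂ (min-first u≤x _)  = <⇒≱ (All.head (proj₂ (++⁻ r x<q))) u≤x
...     | inj₂ (decreasing t≤x _) = <⇒≱ x<t t≤x

spell-immovable : ∀ (N : Vec ℕ m) c → Ascending N → All (z <_) (toList N) →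
  ¬ Movable (spell N c ++ z ∷ [])
spell-immovable []          _ _ _ (there ())
spell-immovable (_ ∷ [])    _ _ _ (there (there ()))
spell-immovable (x ∷ y ∷ N) (i , c) (x< ∷ N↗) (z<x ∷ _) =
  immovable-extend (spell N′ c) (All-resp-↭ (↭-sym (spell-↭ N′ c)) x<N′) (lookup-All (y ∷ N) i x<) z<x
    (spell-immovable N′ c (removeAt-ascending (y ∷ N) i N↗) x<N′)
  where
  N′ : Vec ℕ _
  N′ = removeAt (y ∷ N) i
  x<N′ = removeAt-All (y ∷ N) i x<

++₂-injective : ∀ p q {a b c d : ℕ} → p ++ a ∷ b ∷ [] ≡ q ++ c ∷ d ∷ [] → p ≡ q × b ≡ d
++₂-injective p q {a} {b} {c} {d} eq
  with pa≡qc , refl ← ∷ʳ-injective (p ++ a ∷ []) (q ++ c ∷ [])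
         (trans (++-assoc p (a ∷ []) (b ∷ [])) (trans eq (sym (++-assoc q (c ∷ []) (d ∷ [])))))
  = proj₁ (∷ʳ-injective p q pa≡qc) , refl

spell-injective : ∀ (N : Vec ℕ m) c d → Ascending N → spell N c ≡ spell N d → c ≡ d
spell-injective []       _ _ _ _ = refl
spell-injective (_ ∷ []) _ _ _ _ = refl
spell-injective (x ∷ y ∷ N) (i , c) (j , d) (_ ∷ N↗) eq
  with eq′ , t≡ ← ++₂-injective (spell (removeAt (y ∷ N) i) c) (spell (removeAt (y ∷ N) j) d) eq
  with refl ← lookup-injective (y ∷ N) i j N↗ t≡
  = cong (i ,_) (spell-injective (removeAt (y ∷ N) i) c d (removeAt-ascending (y ∷ N) i N↗) eq′)

mutual
  spell-surjective : ∀ m (N : Vec ℕ m) → Ascending N → All (z <_) (toList N) →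
    w ↭ toList N → ¬ Movable (w ++ z ∷ []) → ∃ λ c → spell N c ≡ w
  spell-surjective zero       []       _ _ p _ = tt , sym (↭-empty-inv p)
  spell-surjective (suc zero) (x ∷ []) _ _ p _ = tt , sym (↭-singleton-inv p)
  spell-surjective {z} (suc (suc m)) (x ∷ y ∷ N) N↗@(x< ∷ _) (z<x ∷ _) p ¬m
    with ∈-∃++ (∈-resp-↭ (↭-sym p) (here refl))
  ... | r , t ∷ [] , refl = spell-last m x y N N↗ p λ m → ¬m (movable-++ʳ (z ∷ []) (movable-prefix r m))
  ... | r , t ∷ u ∷ s , refl
    with _ , _ ∷ x≤t ∷ x≤u ∷ _ ← ++⁻ r (All-resp-↭ (↭-sym p) (≤-refl ∷ All.map <⇒≤ x<)) =
    ⊥-elim (¬m (movable-++ʳ (z ∷ []) (movable-++ˡ r (here (min-first x≤t x≤u)))))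
  ... | r , [] , refl with initLast r
  ...   | [] with () ← ↭-length p
  ...   | r′ ∷ʳ′ u =
    ⊥-elim (¬m (subst Movable (sym eq) (movable-++ˡ r′ (here (decreasing (<⇒≤ z<x) x≤u)))))
    where
    eq : ((r′ ++ u ∷ []) ++ x ∷ []) ++ z ∷ [] ≡ r′ ++ u ∷ x ∷ z ∷ []
    eq = trans (++-assoc (r′ ++ u ∷ []) (x ∷ []) (z ∷ [])) (++-assoc r′ (u ∷ []) (x ∷ z ∷ []))
    x≤u : x ≤ u
    x≤u = All.head (proj₂ (++⁻ r′ (proj₁ (++⁻ (r′ ++ u ∷ [])
            (All-resp-↭ (↭-sym p) (≤-refl ∷ All.map <⇒≤ x<))))))

  spell-last : ∀ m x y (N : Vec ℕ m) → Ascending (x ∷ y ∷ N) → w ++ x ∷ t ∷ [] ↭ x ∷ y ∷ toList N →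
    ¬ Movable (w ++ x ∷ []) → ∃ λ c → spell (x ∷ y ∷ N) c ≡ w ++ x ∷ t ∷ []
  spell-last {w} {t} m x y N (x< ∷ N↗) p ¬m
    with p′ ← drop-∷ (↭-trans (++-comm (x ∷ t ∷ []) w) p)
    with i , refl ← ∈⇒lookup (y ∷ N) (∈-resp-↭ p′ (here refl))
    with c , refl ← spell-surjective m (removeAt (y ∷ N) i) (removeAt-ascending (y ∷ N) i N↗)
           (removeAt-All (y ∷ N) i x<) (drop-∷ (↭-trans p′ (removeAt-↭ (y ∷ N) i))) ¬m
    = (i , c) , refl

  movable-prefix : ∀ r → Movable (r ++ x ∷ []) → Movable (r ++ x ∷ t ∷ [])
  movable-prefix {x} {t} r m = subst Movable (++-assoc r (x ∷ []) (t ∷ [])) (movable-++ʳ (t ∷ []) m)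

-- Representatives of the classes

-- The classes of movable permutations are numbered by the number i = e + 2m of letters
-- before the letter 1 in the canonical word, with e read as 0 or 1; thus e is the
-- parity of i, and m is its half.
isOdd : ℕ → Bool
isOdd zero          = false
isOdd (suc zero)    = true
isOdd (suc (suc i)) = isOdd i

-- The number of letters before the letter 1 in a canonical word.
depth : Bool → ℕ → ℕ
depth false m = m + m
depth true  m = suc (m + m)

depth-suc : ∀ e m → depth e (suc m) ≡ 2 + depth e m
depth-suc false m = cong suc (+-suc m m)
depth-suc true  m = cong (2 +_) (+-suc m m)

depth-isOdd-half : ∀ i → depth (isOdd i) ⌊ i /2⌋ ≡ i
depth-isOdd-half zero          = refl
depth-isOdd-half (suc zero)    = refl
depth-isOdd-half (suc (suc i)) = trans (depth-suc (isOdd i) ⌊ i /2⌋) (cong (2 +_) (depth-isOdd-half i))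

isOdd-depth : ∀ e m → isOdd (depth e m) ≡ e
isOdd-depth false zero    = refl
isOdd-depth true  zero    = refl
isOdd-depth e     (suc m) = trans (cong isOdd (depth-suc e m)) (isOdd-depth e m)

half-depth : ∀ e m → ⌊ depth e m /2⌋ ≡ m
half-depth false zero    = refl
half-depth true  zero    = refl
half-depth e     (suc m) = trans (cong ⌊_/2⌋ (depth-suc e m)) (cong suc (half-depth e m))

size-suc : ∀ e m r → size e (suc m) (suc r) ≡ 2 + size e m r
size-suc false m r = cong (2 +_) (+-suc m r)
size-suc true  m r = cong (3 +_) (+-suc m r)

size-injective : ∀ e m {r r′} → size e m r ≡ size e m r′ → r ≡ r′
size-injective false m = +-cancelˡ-≡ (suc m) _ _
size-injective true  m = +-cancelˡ-≡ (2 + m) _ _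

-- The argument r for which the canonical word numbered i has 2 + k letters.
remainder : ∀ i k → i < k → ∃ λ r → 2 + k ≡ size (isOdd i) ⌊ i /2⌋ r × suc ⌊ i /2⌋ < r
remainder zero          (suc k) i<k = 2 + k , refl , s≤s (s≤s z≤n)
remainder (suc zero)    k i<k = k , refl , i<k
remainder (suc (suc i)) (suc (suc k)) (s≤s (s≤s i<k)) with r , eq , m<r ← remainder i k i<k =
  suc r , trans (cong (2 +_) eq) (sym (size-suc (isOdd i) ⌊ i /2⌋ r)) , s≤s m<r

+-suc-suc : ∀ m → m + (2 + m) ≡ 2 + (m + m)
+-suc-suc m = trans (+-suc m (suc m)) (cong suc (+-suc m m))

depth-< : ∀ e m r {k} → 2 + k ≡ size e m r → suc m < r → depth e m < k
depth-< false m r eq m<r = +-cancelˡ-≤ 2 _ _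
  (subst₂ _≤_ (cong suc (+-suc-suc m)) (sym eq) (+-monoʳ-≤ (suc m) m<r))
depth-< true  m r eq m<r =
  subst₂ _≤_ (+-suc-suc m) (sym (suc-injective (suc-injective eq))) (+-monoʳ-≤ m m<r)

canonical-↭ : ∀ e m r → canonical e m r ↭ letters (size e m r)
canonical-↭ false m r = ↭-trans (⋈-↭ (countdown (suc m)) (toList (upFrom (2 + m) r)))
  (↭-trans (++↭ʳ++ (countdown (suc m)) _) (↭-reflexive (countdown-upFrom (suc m) r)))
canonical-↭ true  m r = ↭-trans (prep (2 + m) (⋈-↭ (countdown (suc m)) L′))
  (↭-trans (↭-sym (shift (2 + m) (countdown (suc m)) L′))
  (↭-trans (++↭ʳ++ (countdown (suc m)) (2 + m ∷ L′))
    (↭-reflexive (trans (countdown-upFrom (suc m) (suc r)) (cong letters (+-suc (suc m) r))))))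
  where
  L′ : List ℕ
  L′ = toList (upFrom (3 + m) r)

canonical-movable : ∀ e m r → suc m < r → Movable (canonical e m r)
canonical-movable false m r m<r =
  movable-⋈ (suc m) (countdown m) (countdown-≼ (suc m) (2 + m) r (n≤1+n _))
  (subst₂ _<_ (cong suc (sym (length-countdown m))) (sym (length-toList (upFrom (2 + m) r))) m<r)
canonical-movable true  m r m<r =
  there (movable-⋈ (suc m) (countdown m) (countdown-≼ (suc m) (3 + m) r (m≤n⇒m≤1+n (n≤1+n _)))
  (subst₂ _<_ (cong suc (sym (length-countdown m))) (sym (length-toList (upFrom (3 + m) r))) m<r))

-- Names of the classes for n = 2 + k: the immovable permutations q1t, the immovable
-- permutations q1, and the classes of movable permutations.
Class : ℕ → Set
Class k = (Code (2 + k) ⊎ Code (1 + k)) ⊎ Fin k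

representative : ∀ k → Class k → List ℕ
representative k (inj₁ (inj₁ c)) = spell (upFrom 1 (2 + k)) c
representative k (inj₁ (inj₂ c)) = spell (upFrom 2 (1 + k)) c ++ 1 ∷ []
representative k (inj₂ i) =
  canonical (isOdd (toℕ i)) ⌊ toℕ i /2⌋ (proj₁ (remainder (toℕ i) k (toℕ<n i)))

representative-↭ : ∀ k i → representative k i ↭ letters (2 + k)
representative-↭ k (inj₁ (inj₁ c)) = spell-↭ (upFrom 1 (2 + k)) c
representative-↭ k (inj₁ (inj₂ c)) =
  ↭-trans (++-comm (spell (upFrom 2 (1 + k)) c) (1 ∷ [])) (prep 1 (spell-↭ (upFrom 2 (1 + k)) c))
representative-↭ k (inj₂ i) with r , eq , _ ← remainder (toℕ i) k (toℕ<n i) =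
  ↭-trans (canonical-↭ (isOdd (toℕ i)) ⌊ toℕ i /2⌋ r) (↭-reflexive (cong letters (sym eq)))

immovable-representative : ∀ k → w ↭ letters (2 + k) → ¬ Movable w →
  ∃ λ i → representative k (inj₁ i) ≡ w
immovable-representative k p ¬m with ∈-∃++ (∈-resp-↭ (↭-sym p) (here refl))
... | q , [] , refl
  with c , eq ← spell-surjective (1 + k) (upFrom 2 (1 + k)) (upFrom-< 2 (1 + k))
         (upFrom-≥ 2 (1 + k)) (drop-∷ (↭-trans (++-comm (1 ∷ []) q) p)) ¬m
  = inj₂ c , cong (_++ 1 ∷ []) eq
... | q , t ∷ [] , refl
  with c , eq ← spell-last k 1 2 (upFrom 3 k) (upFrom-< 1 (2 + k)) p (λ m → ¬m (movable-prefix q m))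
  = inj₁ c , eq
... | q , t ∷ u ∷ s , refl
  with _ , _ ∷ 1≤t ∷ 1≤u ∷ _ ← ++⁻ q (All-resp-↭ (↭-sym p) (upFrom-≥ 1 (2 + k)))
  = ⊥-elim (¬m (movable-++ˡ q (here (min-first 1≤t 1≤u))))

representative-complete : ∀ k → 5 ≤ 2 + k → w ↭ letters (2 + k) → ∃ λ i → w ≈ representative k i
representative-complete {w} k 5≤n p with movable? w
... | no ¬m with i , eq ← immovable-representative k p ¬m = inj₁ i , ≈-reflexive (sym eq)
... | yes mv with e , m , r , n≡ , m<r , f ← canonical-form 5≤n p (standardise _ w ≤-refl mv)
  = inj₂ i , ≈-trans f (≈-reflexive canonical≡)
  where
  i<k : depth e m < k
  i<k = depth-< e m r n≡ m<r
  i : Fin k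
  i = fromℕ< i<k
  e≡ : isOdd (toℕ i) ≡ e
  e≡ = trans (cong isOdd (toℕ-fromℕ< i<k)) (isOdd-depth e m)
  m≡ : ⌊ toℕ i /2⌋ ≡ m
  m≡ = trans (cong ⌊_/2⌋ (toℕ-fromℕ< i<k)) (half-depth e m)
  canonical≡ : canonical e m r ≡ representative k (inj₂ i)
  canonical≡ with r′ , n≡′ , _ ← remainder (toℕ i) k (toℕ<n i) rewrite e≡ | m≡ =
    cong (canonical e m) (size-injective e m (trans (sym n≡) n≡′))

representative-immovable : ∀ k i → ¬ Movable (representative k (inj₁ i))
representative-immovable k (inj₁ c) m =
  spell-immovable (upFrom 1 (2 + k)) c (upFrom-< 1 (2 + k)) (upFrom-≥ 1 (2 + k))
    (movable-++ʳ (0 ∷ []) m)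
representative-immovable k (inj₂ c) =
  spell-immovable (upFrom 2 (1 + k)) c (upFrom-< 2 (1 + k)) (upFrom-≥ 2 (1 + k))

representative-movable : ∀ k i → Movable (representative k (inj₂ i))
representative-movable k i with r , _ , m<r ← remainder (toℕ i) k (toℕ<n i) =
  canonical-movable (isOdd (toℕ i)) ⌊ toℕ i /2⌋ r m<r

-- A word with a code in Code (2 + k) ends with a letter other than 1.
spell≢snoc : ∀ k (c : Code (2 + k)) q → spell (upFrom 1 (2 + k)) c ≢ q ++ 1 ∷ []
spell≢snoc k (i , c) q eq = <⇒≢ (lookup-All (upFrom 2 (suc k)) i (upFrom-≥ 2 (suc k)))
  (sym (∷ʳ-injectiveʳ (r ++ 1 ∷ []) q (trans (++-assoc r (1 ∷ []) _) eq)))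
  where
  r : List ℕ
  r = spell (removeAt (upFrom 2 (suc k)) i) c

immovable-distinct : ∀ k i j → representative k (inj₁ i) ≡ representative k (inj₁ j) → i ≡ j
immovable-distinct k (inj₁ c) (inj₁ d) eq =
  cong inj₁ (spell-injective (upFrom 1 (2 + k)) c d (upFrom-< 1 (2 + k)) eq)
immovable-distinct k (inj₂ c) (inj₂ d) eq =
  cong inj₂ (spell-injective (upFrom 2 (1 + k)) c d (upFrom-< 2 (1 + k)) (∷ʳ-injectiveˡ _ _ eq))
immovable-distinct k (inj₁ c) (inj₂ d) eq = ⊥-elim (spell≢snoc k c _ eq)
immovable-distinct k (inj₂ c) (inj₁ d) eq = ⊥-elim (spell≢snoc k d _ (sym eq))

representative-distinct : ∀ k i j → representative k i ≈ representative k j → i ≡ j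
representative-distinct k (inj₁ i) (inj₁ j) f =
  cong inj₁ (immovable-distinct k i j (immovable-alone (representative-immovable k i) f))
representative-distinct k (inj₁ i) (inj₂ j) f =
  ⊥-elim (immovable≉movable (representative-immovable k i) (representative-movable k j) f)
representative-distinct k (inj₂ i) (inj₁ j) f =
  ⊥-elim (immovable≉movable (representative-immovable k j) (representative-movable k i) (≈-sym f))
representative-distinct k (inj₂ i) (inj₂ j) f
  with r , _ , m<r ← remainder (toℕ i) k (toℕ<n i) | r′ , _ , m′<r′ ← remainder (toℕ j) k (toℕ<n j)
  with e≡ , m≡ ← canonical-distinct (isOdd (toℕ i)) ⌊ toℕ i /2⌋ r
                   (isOdd (toℕ j)) ⌊ toℕ j /2⌋ r′ m<r m′<r′ f
  = cong inj₂ (toℕ-injective (toℕ≡ e≡ m≡))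
  where
  toℕ≡ : isOdd (toℕ i) ≡ isOdd (toℕ j) → ⌊ toℕ i /2⌋ ≡ ⌊ toℕ j /2⌋ → toℕ i ≡ toℕ j
  toℕ≡ e≡ m≡ = trans (sym (depth-isOdd-half (toℕ i)))
    (trans (cong₂ depth e≡ m≡) (depth-isOdd-half (toℕ j)))

Class↔Fin : ∀ k → Fin ((suc k) !! + k !! + k) ↔ Class k
Class↔Fin k =
  ((↔-sym (Code↔Fin (suc k)) ⊎-↔ ↔-sym (Code↔Fin k)) ↔-∘ +↔⊎ ⊎-↔ ↔-id (Fin k)) ↔-∘ +↔⊎

-- Permutations and their words

∈-upFrom : ∀ k r → k ≤ x → x < k + r → x ∈ toList (upFrom k r)
∈-upFrom {x} k zero    k≤x x<k = ⊥-elim (<⇒≱ x<k (subst (_≤ x) (sym (+-identityʳ k)) k≤x))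
∈-upFrom {x} k (suc r) k≤x x<k with m≤n⇒m<n∨m≡n k≤x
... | inj₁ k<x  = there (∈-upFrom (suc k) r k<x (subst (x <_) (+-suc k r) x<k))
... | inj₂ refl = here refl

unique-⊆ : Unique L₁ → L₁ ⊆ L₂ → ∃ λ R → L₂ ↭ L₁ ++ R
unique-⊆ {[]}          []        _   = _ , ↭-refl
unique-⊆ {x ∷ L₁} {L₂} (x≢ ∷ u) sub with ys , zs , refl ← ∈-∃++ (sub (here refl)) =
  let R , p = unique-⊆ {L₁} {ys ++ zs} u sub′ in R , ↭-trans (shift x ys zs) (prep x p)
  where
  sub′ : L₁ ⊆ ys ++ zs
  sub′ y∈ with ∈-++⁻ ys (sub (there y∈))
  ... | inj₁ y∈ys         = ∈-++⁺ˡ y∈ys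
  ... | inj₂ (here refl)  = ⊥-elim (All.lookup x≢ y∈ refl)
  ... | inj₂ (there y∈zs) = ∈-++⁺ʳ ys y∈zs

unique-⊆-↭ : Unique L₁ → L₁ ⊆ L₂ → length L₁ ≡ length L₂ → L₁ ↭ L₂
unique-⊆-↭ {L₁} u sub len with unique-⊆ u sub
... | [] , p = ↭-sym (↭-trans p (↭-reflexive (++-identityʳ L₁)))
... | x ∷ R , p = ⊥-elim (m≢1+m+n (length L₁)
  (trans len (trans (↭-length p) (trans (length-++ L₁) (+-suc _ _)))))

AllPairs-toList⁺ : ∀ {R : ℕ → ℕ → Set} {u : Vec ℕ n} →
  VecAllPairs.AllPairs R u → AllPairs R (toList u)
AllPairs-toList⁺ VecAllPairs.[]         = []
AllPairs-toList⁺ (px VecAllPairs.∷ ps) = VecAll.toList⁺ px ∷ AllPairs-toList⁺ ps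

AllPairs-toList⁻ : ∀ {R : ℕ → ℕ → Set} {u : Vec ℕ n} →
  AllPairs R (toList u) → VecAllPairs.AllPairs R u
AllPairs-toList⁻ {u = []}    []        = VecAllPairs.[]
AllPairs-toList⁻ {u = _ ∷ _} (px ∷ ps) = VecAll.toList⁻ px VecAllPairs.∷ AllPairs-toList⁻ ps

-- The word of a permutation, as a list.
letterList : S n → List ℕ
letterList φ = toList (word φ)

letterList-injective : ∀ (φ ψ : S n) → letterList φ ≡ letterList ψ → φ ≡ ψ
letterList-injective (permutation u _) (permutation v _) eq
  with refl ← trans (sym (cast-is-id refl u)) (toList-injective refl u v eq) = refl

letterList-↭ : ∀ (φ : S n) → letterList φ ↭ letters n
letterList-↭ {n} (permutation u isPerm) with bounds , unique ← recompute (isPermutation? u) isPerm =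
  unique-⊆-↭ (AllPairs-toList⁺ unique)
    (λ x∈ → let 1≤x , x≤n = All.lookup (VecAll.toList⁺ bounds) x∈ in ∈-upFrom 1 n 1≤x (s≤s x≤n))
    (trans (length-toList u) (sym (length-toList (upFrom 1 n))))

letters-unique : ∀ n → w ↭ letters n → Unique w
letters-unique n p =
  Permutationₛ.Unique-resp-↭ (≡.setoid ℕ) (↭.↭⇒↭ₛ (↭-sym p)) (AllPairs.map <⇒≢ (upFrom-< 1 n))

upFrom-bounded : ∀ k r → All (_< k + r) (toList (upFrom k r))
upFrom-bounded k zero    = []
upFrom-bounded k (suc r) rewrite +-suc k r = s≤s (m≤m+n k r) ∷ upFrom-bounded (suc k) r

-- Every rearrangement of 1, ..., n is the word of a permutation.
fromLetterList : w ↭ letters n → ∃ λ (φ : S n) → letterList φ ≡ w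
fromLetterList {w} {n} p with refl ← trans (↭-length p) (length-toList (upFrom 1 n)) =
  permutation (fromList w)
    ( VecAll.fromList⁺ (All.zipWith (λ (l , u) → l , s≤s⁻¹ u)
        (All-resp-↭ (↭-sym p) (upFrom-≥ 1 n) , All-resp-↭ (↭-sym p) (upFrom-bounded 1 n)))
    , AllPairs-toList⁻ (subst Unique (sym (toList∘fromList w)) (letters-unique n p)))
  , toList∘fromList w

-- Moves as replacements

lookup-increasing : a < b → b < c → ∀ i j → i Fin.< j →
  lookup (a ∷ b ∷ c ∷ []) i < lookup (a ∷ b ∷ c ∷ []) j
lookup-increasing a<b b<c zero             (suc zero)       _ = a<b
lookup-increasing a<b b<c zero             (suc (suc zero)) _ = <-trans a<b b<c
lookup-increasing a<b b<c (suc zero)       (suc (suc zero)) _ = b<c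
lookup-increasing _ _ (suc zero)       (suc zero)       (s≤s ())
lookup-increasing _ _ (suc (suc zero)) (suc zero)       (s≤s ())
lookup-increasing _ _ (suc (suc zero)) (suc (suc zero)) (s≤s (s≤s ()))

increasing-⇔ : (f : Fin n → ℕ) → (∀ i j → i Fin.< j → f i < f j) → ∀ i j → i Fin.< j ⇔ f i < f j
increasing-⇔ f mono i j = mk⇔ (mono i j) back
  where
  back : f i < f j → i Fin.< j
  back fi<fj with Fin.<-cmp i j
  ... | tri< i<j _ _    = i<j
  ... | tri≈ _ refl _   = ⊥-elim (<-irrefl refl fi<fj)
  ... | tri> _ _ j<i    = ⊥-elim (<-asym fi<fj (mono j i j<i))

order-123 : a < b → b < c → IsOrderPermutation (a ∷ b ∷ c ∷ []) perm123
order-123 {a} {b} {c} a<b b<c i j =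
  increasing-⇔ (lookup (a ∷ b ∷ c ∷ [])) (lookup-increasing a<b b<c) i j ⇔-∘
  ⇔-sym (increasing-⇔ (lookup (1 ∷ 2 ∷ 3 ∷ [])) (lookup-increasing ≤-refl ≤-refl) i j)

-- Permuting the entries of a word and of its order permutation in the same way.
order-reindex : ∀ (u u′ : Vec ℕ 3) (σ σ′ : S 3) (π : Fin 3 → Fin 3) →
  (∀ i → lookup u′ i ≡ lookup u (π i)) → (∀ i → lookup (word σ′) i ≡ lookup (word σ) (π i)) →
  IsOrderPermutation u σ → IsOrderPermutation u′ σ′
order-reindex u u′ σ σ′ π u≡ σ≡ ord i j rewrite u≡ i | u≡ j | σ≡ i | σ≡ j = ord (π i) (π j)

order-132 : a < b → b < c → IsOrderPermutation (a ∷ c ∷ b ∷ []) perm132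
order-132 {a} {b} {c} a<b b<c = order-reindex (a ∷ b ∷ c ∷ []) (a ∷ c ∷ b ∷ []) perm123 perm132
  (lookup (zero ∷ suc (suc zero) ∷ suc zero ∷ []))
  (λ { zero → refl ; (suc zero) → refl ; (suc (suc zero)) → refl })
  (λ { zero → refl ; (suc zero) → refl ; (suc (suc zero)) → refl })
  (order-123 a<b b<c)

order-321 : a < b → b < c → IsOrderPermutation (c ∷ b ∷ a ∷ []) perm321
order-321 {a} {b} {c} a<b b<c = order-reindex (a ∷ b ∷ c ∷ []) (c ∷ b ∷ a ∷ []) perm123 perm321
  (lookup (suc (suc zero) ∷ suc zero ∷ zero ∷ []))
  (λ { zero → refl ; (suc zero) → refl ; (suc (suc zero)) → refl })
  (λ { zero → refl ; (suc zero) → refl ; (suc (suc zero)) → refl })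
  (order-123 a<b b<c)

-- A move, with the prefix p made explicit.
data Split⟶ : List ℕ → List ℕ → Set where
  123→132 : ∀ p s → a ≤ b → b ≤ c → Split⟶ (p ++ a ∷ b ∷ c ∷ s) (p ++ a ∷ c ∷ b ∷ s)
  123→321 : ∀ p s → a ≤ b → b ≤ c → Split⟶ (p ++ a ∷ b ∷ c ∷ s) (p ++ c ∷ b ∷ a ∷ s)

split : w ⟶ w′ → Split⟶ w w′
split (123→132 a≤b b≤c) = 123→132 [] _ a≤b b≤c
split (123→321 a≤b b≤c) = 123→321 [] _ a≤b b≤c
split (there {x = x} st) with split st
... | 123→132 p s a≤b b≤c = 123→132 (x ∷ p) s a≤b b≤c
... | 123→321 p s a≤b b≤c = 123→321 (x ∷ p) s a≤b b≤c

unique-middle : ∀ p → Unique (p ++ a ∷ b ∷ c ∷ s) → a ≢ b × b ≢ c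
unique-middle []      ((a≢b ∷ _) ∷ (b≢c ∷ _) ∷ _) = a≢b , b≢c
unique-middle (_ ∷ p) (_ ∷ u)                     = unique-middle p u

⟶⇒Replacement : ∀ (φ ψ : S n) → letterList φ ⟶ letterList ψ → Replacement K φ ψ
⟶⇒Replacement {n} φ ψ st = go (split st) refl refl
  where
  go : Split⟶ w w′ → letterList φ ≡ w → letterList ψ ≡ w′ → Replacement K φ ψ
  go (123→132 {a = a} {b = b} {c = c} p s a≤b b≤c) eq eq′
    with a≢b , b≢c ← unique-middle p (subst Unique eq (letters-unique n (letterList-↭ φ))) = record
    { φ≡ = eq ; ψ≡ = eq′
    ; u = a ∷ b ∷ c ∷ [] ; v = a ∷ c ∷ b ∷ []
    ; σ-order = order-123 (≤∧≢⇒< a≤b a≢b) (≤∧≢⇒< b≤c b≢c)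
    ; τ-order = order-132 (≤∧≢⇒< a≤b a≢b) (≤∧≢⇒< b≤c b≢c)
    ; samePart = inj₂ (here (here refl , there (here refl))) }
  go (123→321 {a = a} {b = b} {c = c} p s a≤b b≤c) eq eq′
    with a≢b , b≢c ← unique-middle p (subst Unique eq (letters-unique n (letterList-↭ φ))) = record
    { φ≡ = eq ; ψ≡ = eq′
    ; u = a ∷ b ∷ c ∷ [] ; v = c ∷ b ∷ a ∷ []
    ; σ-order = order-123 (≤∧≢⇒< a≤b a≢b) (≤∧≢⇒< b≤c b≢c)
    ; τ-order = order-321 (≤∧≢⇒< a≤b a≢b) (≤∧≢⇒< b≤c b≢c)
    ; samePart = inj₂ (here (here refl , there (there (here refl)))) }

infix 4 _≈ᴷ_

-- The equivalence of permutations whose classes are counted.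
_≈ᴷ_ : S n → S n → Set
_≈ᴷ_ = EqClosure.EqClosure (Replacement K)

-- A chain of moves between words of permutations passes through words of permutations.
≈⇒≈ᴷ : ∀ {w w′} (φ ψ : S n) → letterList φ ≡ w → letterList ψ ≡ w′ → w ≈ w′ → φ ≈ᴷ ψ
≈⇒≈ᴷ φ ψ eq eq′ ε with refl ← letterList-injective φ ψ (trans eq (sym eq′)) = ε
≈⇒≈ᴷ φ ψ refl eq′ (fwd st ◅ e) with χ , refl ← fromLetterList (↭-trans (↭-sym (⟶-↭ st)) (letterList-↭ φ)) =
  fwd (⟶⇒Replacement φ χ st) ◅ ≈⇒≈ᴷ χ ψ refl eq′ e
≈⇒≈ᴷ φ ψ refl eq′ (bwd st ◅ e) with χ , refl ← fromLetterList (↭-trans (⟶-↭ st) (letterList-↭ φ)) =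
  bwd (⟶⇒Replacement χ φ st) ◅ ≈⇒≈ᴷ χ ψ refl eq′ e

-- Replacements as chains of moves

-- The number of letters of L that are less than x.
rank : ℕ → List ℕ → ℕ
rank x L = length (filter (_<? x) L)

rank-accept : ∀ L → z < x → rank x (z ∷ L) ≡ suc (rank x L)
rank-accept {x = x} L z<x = cong length (filter-accept (_<? x) z<x)

rank-reject : ∀ L → ¬ z < x → rank x (z ∷ L) ≡ rank x L
rank-reject {x = x} L z≮x = cong length (filter-reject (_<? x) z≮x)

rank-mono : ∀ L → x ≤ y → rank x L ≤ rank y L
rank-mono []      _ = z≤n
rank-mono {x} {y} (z ∷ L) x≤y with z <? x | z <? y
... | yes z<x | yes z<y rewrite rank-accept L z<x | rank-accept L z<y = s≤s (rank-mono L x≤y)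
... | yes z<x | no z≮y = ⊥-elim (z≮y (≤-trans z<x x≤y))
... | no z≮x  | yes z<y rewrite rank-reject L z≮x | rank-accept L z<y = m≤n⇒m≤1+n (rank-mono L x≤y)
... | no z≮x  | no z≮y rewrite rank-reject L z≮x | rank-reject L z≮y = rank-mono L x≤y

rank-strict : x ∈ L → x < y → rank x L < rank y L
rank-strict {x} {_ ∷ L} {y} (here refl) x<y
  rewrite rank-reject L (<-irrefl {x} refl) | rank-accept L x<y = s≤s (rank-mono L (<⇒≤ x<y))
rank-strict {x} {z ∷ L} {y} (there x∈) x<y with z <? x | z <? y
... | yes z<x | yes z<y rewrite rank-accept L z<x | rank-accept L z<y = s≤s (rank-strict x∈ x<y)
... | yes z<x | no z≮y = ⊥-elim (z≮y (<-trans z<x x<y))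
... | no z≮x  | yes z<y rewrite rank-reject L z≮x | rank-accept L z<y = m≤n⇒m≤1+n (rank-strict x∈ x<y)
... | no z≮x  | no z≮y rewrite rank-reject L z≮x | rank-reject L z≮y = rank-strict x∈ x<y

rank-injective : x ∈ L → y ∈ L → rank x L ≡ rank y L → x ≡ y
rank-injective {x} {L} {y} x∈ y∈ eq with <-cmp x y
... | tri< x<y _ _ = ⊥-elim (<⇒≢ (rank-strict x∈ x<y) eq)
... | tri≈ _ x≡y _ = x≡y
... | tri> _ _ y<x = ⊥-elim (<⇒≢ (rank-strict y∈ y<x) (sym eq))

rank-cong : ∀ (u v : Vec ℕ n) → (∀ j → lookup u j < x ⇔ lookup v j < y) →
  rank x (toList u) ≡ rank y (toList v)
rank-cong []      []      _   = refl
rank-cong {x = x} {y} (c ∷ u) (d ∷ v) iff with c <? x | d <? y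
... | yes c<x | yes d<y rewrite rank-accept (toList u) c<x | rank-accept (toList v) d<y =
  cong suc (rank-cong u v (λ j → iff (suc j)))
... | yes c<x | no d≮y = ⊥-elim (d≮y (Equivalence.to (iff zero) c<x))
... | no c≮x  | yes d<y = ⊥-elim (c≮x (Equivalence.from (iff zero) d<y))
... | no c≮x  | no d≮y rewrite rank-reject (toList u) c≮x | rank-reject (toList v) d≮y =
  rank-cong u v (λ j → iff (suc j))

lookup-∈ : ∀ (u : Vec ℕ n) i → lookup u i ∈ toList u
lookup-∈ (_ ∷ _) zero    = here refl
lookup-∈ (_ ∷ u) (suc i) = there (lookup-∈ u i)

lookup-ext : ∀ (u v : Vec ℕ n) → (∀ i → lookup u i ≡ lookup v i) → u ≡ v
lookup-ext []      []      _  = refl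
lookup-ext (_ ∷ u) (_ ∷ v) eq = cong₂ _∷_ (eq zero) (lookup-ext u v (λ i → eq (suc i)))

-- A word is determined by its letters and its order permutation, since the rank of each
-- letter is.
order-determines : ∀ (u v : Vec ℕ n) (σ : S n) → IsOrderPermutation u σ → IsOrderPermutation v σ →
  toList u ↭ toList v → u ≡ v
order-determines u v σ uσ vσ p = lookup-ext u v λ i →
  rank-injective (lookup-∈ u i) (∈-resp-↭ (↭-sym p) (lookup-∈ v i))
  (trans (rank-cong u v (λ j → vσ j i ⇔-∘ ⇔-sym (uσ j i)))
    (↭-length (filter-↭ (_<? lookup v i) (↭-sym p))))

-- A window that is equivalent, with any suffix, to its increasing rearrangement.
record Sorted (u : Vec ℕ 3) : Set where
  constructor sorted
  field
    {least middle greatest} : ℕ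
    least≤middle : least ≤ middle
    middle≤greatest : middle ≤ greatest
    sorted-↭ : toList u ↭ least ∷ middle ∷ greatest ∷ []
    sorted-≈ : toList u ++ s ≈ least ∷ middle ∷ greatest ∷ s

-- The nontrivial part of K.
K-part : List (S 3)
K-part = perm123 ∷ perm132 ∷ perm321 ∷ []

sort-part : ∀ (u : Vec ℕ 3) {σ} → IsOrderPermutation u σ → σ ∈ K-part → Sorted u
sort-part (x ∷ y ∷ z ∷ []) ord (here refl) = sorted x≤y y≤z ↭-refl ≈-refl
  where
  x≤y = <⇒≤ (Equivalence.to (ord zero (suc zero)) ≤-refl)
  y≤z = <⇒≤ (Equivalence.to (ord (suc zero) (suc (suc zero))) ≤-refl)
sort-part (x ∷ y ∷ z ∷ []) ord (there (here refl)) =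
  sorted x≤z z≤y (prep x (swap y z ↭-refl)) (≈-sym (flip-tail x≤z z≤y))
  where
  x≤z = <⇒≤ (Equivalence.to (ord zero (suc (suc zero))) ≤-refl)
  z≤y = <⇒≤ (Equivalence.to (ord (suc (suc zero)) (suc zero)) ≤-refl)
sort-part (x ∷ y ∷ z ∷ []) ord (there (there (here refl))) =
  sorted z≤y y≤x (↭-trans (++-comm (x ∷ y ∷ []) (z ∷ [])) (prep z (swap x y ↭-refl)))
    (≈-sym (reversal z≤y y≤x))
  where
  z≤y = <⇒≤ (Equivalence.to (ord (suc (suc zero)) (suc zero)) ≤-refl)
  y≤x = <⇒≤ (Equivalence.to (ord (suc zero) zero) ≤-refl)

ascending-triple : a ≤ b → b ≤ c → AllPairs _≤_ (a ∷ b ∷ c ∷ [])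
ascending-triple a≤b b≤c = (a≤b ∷ ≤-trans a≤b b≤c ∷ []) ∷ (b≤c ∷ []) ∷ [] ∷ []

sorted-agree : ∀ (u v : Vec ℕ 3) → toList u ↭ toList v → Sorted u → Sorted v →
  toList u ++ s ≈ toList v ++ s
sorted-agree u v p (sorted a≤b b≤c q f) (sorted a≤b′ b≤c′ q′ f′)
  with refl ← ascending-unique (ascending-triple a≤b b≤c) (ascending-triple a≤b′ b≤c′)
                (↭-trans (↭-sym q) (↭-trans p q′))
  = ≈-trans f (≈-sym f′)

↭-cancel-prefix : ∀ p → p ++ L₁ ↭ p ++ L₂ → L₁ ↭ L₂
↭-cancel-prefix []      q = q
↭-cancel-prefix (_ ∷ p) q = ↭-cancel-prefix p (drop-∷ q)

-- The two windows have the same letters, as prefix and suffix agree.  With the same order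
-- permutation they are equal; with order permutations in the nontrivial part, both are
-- equivalent to the same increasing window.
Replacement⇒≈ : ∀ {φ ψ : S n} → Replacement K φ ψ → letterList φ ≈ letterList ψ
Replacement⇒≈ {n} {φ} {ψ} r = begin
  letterList φ                ≡⟨ φ≡ ⟩
  prefix ++ toList u ++ suffix ≈⟨ prefix⁺ prefix (agree samePart) ⟩
  prefix ++ toList v₀ ++ suffix ≡⟨ ψ≡ ⟨
  letterList ψ                ∎
  where
  open Replacement r renaming (v to v₀)
  full : prefix ++ toList u ++ suffix ↭ prefix ++ toList v₀ ++ suffix
  full = ↭-trans (↭-reflexive (sym φ≡)) (↭-trans (letterList-↭ φ)
           (↭-trans (↭-sym (letterList-↭ ψ)) (↭-reflexive ψ≡)))
  u↭v : toList u ↭ toList v₀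
  u↭v = ↭-cancel-prefix suffix (↭-trans (++-comm suffix (toList u))
          (↭-trans (↭-cancel-prefix prefix full) (++-comm (toList v₀) suffix)))
  agree : SamePart K σ τ → toList u ++ suffix ≈ toList v₀ ++ suffix
  agree (inj₁ refl) with refl ← order-determines u v₀ σ σ-order τ-order u↭v = ≈-refl
  agree (inj₂ (here (σ∈ , τ∈))) =
    sorted-agree u v₀ u↭v (sort-part u σ-order σ∈) (sort-part v₀ τ-order τ∈)

≈ᴷ⇒≈ : ∀ {φ ψ : S n} → φ ≈ᴷ ψ → letterList φ ≈ letterList ψ
≈ᴷ⇒≈ = EqClosure.gfold (EqClosure.isEquivalence _⟶_) letterList Replacement⇒≈

-- Counting

hasClassCount : ∀ k → 5 ≤ 2 + k → HasClassCount (S[ 2 + k ]/ K) (suc k !! + k !! + k)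
hasClassCount k 5≤n = record
  { to        = λ φ → Index.from (class φ)
  ; from      = λ i → rep (Index.to i)
  ; to-cong   = λ {φ} {ψ} φ≈ψ → cong Index.from
      (class-unique φ (class ψ) (≈-trans (≈ᴷ⇒≈ φ≈ψ) (class-≈ ψ)))
  ; from-cong = λ { refl → ε }
  ; inverse   =
      (λ {i} {φ} φ≈ → trans
        (cong Index.from (class-unique φ (Index.to i)
          (≈-trans (≈ᴷ⇒≈ φ≈) (≈-reflexive (rep-≡ (Index.to i))))))
        (Index.strictlyInverseʳ i))
    , (λ {φ} {i} i≡ → ≈⇒≈ᴷ (rep (Index.to i)) φ (rep-≡ (Index.to i)) refl
        (≈-trans (≈-reflexive (cong (representative k)
                   (trans (cong Index.to i≡) (Index.strictlyInverseˡ (class φ)))))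
                 (≈-sym (class-≈ φ))))
  }
  where
  module Index = Inverse (Class↔Fin k)
  class : S (2 + k) → Class k
  class φ = proj₁ (representative-complete k 5≤n (letterList-↭ φ))
  class-≈ : ∀ φ → letterList φ ≈ representative k (class φ)
  class-≈ φ = proj₂ (representative-complete k 5≤n (letterList-↭ φ))
  class-unique : ∀ φ i → letterList φ ≈ representative k i → class φ ≡ i
  class-unique φ i f = representative-distinct k (class φ) i (≈-trans (≈-sym (class-≈ φ)) f)
  rep : Class k → S (2 + k)
  rep i = proj₁ (fromLetterList (representative-↭ k i))
  rep-≡ : ∀ i → letterList (rep i) ≡ representative k i
  rep-≡ i = proj₂ (fromLetterList (representative-↭ k i))

proposition2p8 : ∀ (n : ℕ) → 5 ≤ n →
    HasClassCount (S[ n ]/ K) ((n ∸ 1) !! + (n ∸ 2) !! + n ∸ 2)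
proposition2p8 (suc zero) (s≤s ())
proposition2p8 (suc (suc k)) 5≤n = subst (HasClassCount (S[ 2 + k ]/ K))
  (sym (+-∸-assoc (suc k !! + k !!) {2 + k} {2} (s≤s (s≤s z≤n)))) (hasClassCount k 5≤n)
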